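{- Let $d \ge 0$ be an integer and let $\mathcal{A}, \mathcal{B} \subseteq \mathbb{R}^d$ be two sets, each of which linearly spans $\mathbb{R}^d$, such that $\langle a, b\rangle \in \{0,1\}$ holds for all $a \in \mathcal{A}$ and $b \in \mathcal{B}$. Then $|\mathcal{A}| \cdot |\mathcal{B}| \le (d+1)\, 2^d$.
   Context: For $a = (a_1,\ldots,a_d)$ and $b = (b_1,\ldots,b_d)$ in $\mathbb{R}^d$, $\langle a, b\rangle = \sum_{i=1}^d a_i b_i$ denotes the standard scalar product. -}

module Defs where

open import Level using (Level; _⊔_)
open import Data.Nat.Base as ℕ using (ℕ)
import Data.Nat.Properties as ℕ
open import Data.Fin.Base using (Fin)
open import Data.Product.Base using (∃; ∃-syntax; Σ-syntax; _×_; _,_; proj₁; proj₂)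
open import Data.Rational.Base as ℚ
  using (ℚ; 0ℚ; 1ℚ; ½; _-_; _<_; _≤_)
  renaming (∣_∣ to abs)
import Data.Rational.Properties as ℚ
open import Data.Rational.Solver using (module +-*-Solver)
open import Data.Vec.Functional using (Vector; foldr; zipWith)
open import Data.Vec.Functional.Relation.Binary.Pointwise using (Pointwise)
open import Function.Definitions using (Injective)
open import Relation.Binary.Core using (Rel)
open import Relation.Binary.PropositionalEquality
  using (_≡_; refl; sym; trans; cong; cong₂; subst)
open import Relation.Unary using (Pred; _∈_)

private
  variable
    ℓ : Level
    d : ℕ

-- A real number is a Cauchy sequence of rationals; the equality of real
-- numbers is _≈_, so ℝ is a setoid.

IsCauchy : (ℕ → ℚ) → Set
IsCauchy x = ∀ ε → 0ℚ < ε → ∃[ N ] ∀ m n → N ℕ.≤ m → N ℕ.≤ n → abs (x m - x n) < ε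

record ℝ : Set where
  constructor mkℝ
  field
    seq    : ℕ → ℚ
    cauchy : IsCauchy seq

open ℝ public

infix 4 _≈_

_≈_ : Rel ℝ _
x ≈ y = ∀ ε → 0ℚ < ε → ∃[ N ] ∀ n → N ℕ.≤ n → abs (seq x n - seq y n) < ε

private
  open +-*-Solver using (solve; _:=_; _:+_; _:-_; _:*_)

+-rearrange : ∀ a b c e → a ℚ.+ b - (c ℚ.+ e) ≡ (a - c) ℚ.+ (b - e)
+-rearrange = solve 4 (λ a b c e → a :+ b :- (c :+ e) := (a :- c) :+ (b :- e)) refl

*-rearrange : ∀ a b c e → a ℚ.* b - c ℚ.* e ≡ a ℚ.* (b - e) ℚ.+ e ℚ.* (a - c)
*-rearrange = solve 4 (λ a b c e → a :* b :- c :* e := a :* (b :- e) :+ e :* (a :- c)) refl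

telescope : ∀ a b → a ≡ (a - b) ℚ.+ b
telescope = solve 2 (λ a b → a := (a :- b) :+ b) refl

half>0 : ∀ {ε} → 0ℚ < ε → 0ℚ < ½ ℚ.* ε
half>0 {ε} 0<ε = ℚ.positive⁻¹ (½ ℚ.* ε) {{ℚ.pos*pos⇒pos ½ ε {{ℚ.positive 0<ε}}}}

half+half : ∀ ε → ½ ℚ.* ε ℚ.+ ½ ℚ.* ε ≡ ε
half+half ε = trans (sym (ℚ.*-distribʳ-+ ε ½ ½)) (ℚ.*-identityˡ ε)

const-cauchy : ∀ q → IsCauchy (λ _ → q)
const-cauchy q ε 0<ε =
  0 , λ _ _ _ _ → subst (_< ε) (sym (cong abs (ℚ.+-inverseʳ q))) 0<ε

+-cauchy : ∀ {x y} → IsCauchy x → IsCauchy y → IsCauchy (λ n → x n ℚ.+ y n)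
+-cauchy {x} {y} cx cy ε 0<ε with cx _ (half>0 0<ε) | cy _ (half>0 0<ε)
... | M , hx | N , hy = M ℕ.⊔ N , λ m n p q → begin-strict
  abs (x m ℚ.+ y m - (x n ℚ.+ y n))
    ≡⟨ cong abs (+-rearrange (x m) (y m) (x n) (y n)) ⟩
  abs ((x m - x n) ℚ.+ (y m - y n))      ≤⟨ ℚ.∣p+q∣≤∣p∣+∣q∣ (x m - x n) (y m - y n) ⟩
  abs (x m - x n) ℚ.+ abs (y m - y n)
    <⟨ ℚ.+-mono-< (hx m n (ℕ.m⊔n≤o⇒m≤o M N p) (ℕ.m⊔n≤o⇒m≤o M N q))
                  (hy m n (ℕ.m⊔n≤o⇒n≤o M N p) (ℕ.m⊔n≤o⇒n≤o M N q)) ⟩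
  ½ ℚ.* ε ℚ.+ ½ ℚ.* ε                   ≡⟨ half+half ε ⟩
  ε                                     ∎
  where
  open ℚ.≤-Reasoning

EventuallyBounded : (ℕ → ℚ) → Set
EventuallyBounded x = ∃[ K ] ∃[ N ] 0ℚ < K × (∀ n → N ℕ.≤ n → abs (x n) ≤ K)

bounded : ∀ {x} → IsCauchy x → EventuallyBounded x
bounded {x} cx with cx 1ℚ (ℚ.positive⁻¹ 1ℚ)
... | N , h = 1ℚ ℚ.+ abs (x N) , N , ℚ.+-mono-<-≤ (ℚ.positive⁻¹ 1ℚ) (ℚ.0≤∣p∣ (x N)) ,
  λ n p → begin
    abs (x n)                        ≡⟨ cong abs (telescope (x n) (x N)) ⟩
    abs ((x n - x N) ℚ.+ x N)        ≤⟨ ℚ.∣p+q∣≤∣p∣+∣q∣ (x n - x N) (x N) ⟩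
    abs (x n - x N) ℚ.+ abs (x N)      ≤⟨ ℚ.+-monoˡ-≤ (abs (x N)) (ℚ.<⇒≤ (h n N p ℕ.≤-refl)) ⟩
    1ℚ ℚ.+ abs (x N)                 ∎
  where
  open ℚ.≤-Reasoning

divide-ε : ∀ {K ε} → 0ℚ < K → 0ℚ < ε → ∃[ δ ] 0ℚ < δ × K ℚ.* δ ≡ ε
divide-ε {K} {ε} 0<K 0<ε =
  ℚ.1/ K ℚ.* ε ,
  ℚ.positive⁻¹ _ {{ℚ.pos*pos⇒pos (ℚ.1/ K) {{ℚ.1/pos⇒pos K}} ε}} ,
  trans (sym (ℚ.*-assoc K (ℚ.1/ K) ε))
        (trans (cong (ℚ._* ε) (ℚ.*-inverseʳ K)) (ℚ.*-identityˡ ε))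
  where
  instance
    K-pos = ℚ.positive 0<K
    ε-pos = ℚ.positive 0<ε
    K-nonZero = ℚ.pos⇒nonZero K

*-bound : ∀ {K δ} p q → 0ℚ < K → abs p ≤ K → abs q < δ → abs (p ℚ.* q) < K ℚ.* δ
*-bound {K} {δ} p q 0<K p≤K q<δ = begin-strict
  abs (p ℚ.* q)        ≡⟨ ℚ.∣p*q∣≡∣p∣*∣q∣ p q ⟩
  abs p ℚ.* abs q    ≤⟨ ℚ.*-monoʳ-≤-nonNeg (abs q) {{ℚ.∣-∣-nonNeg q}} p≤K ⟩
  K ℚ.* abs q        <⟨ ℚ.*-monoʳ-<-pos K {{ℚ.positive 0<K}} q<δ ⟩
  K ℚ.* δ            ∎
  where
  open ℚ.≤-Reasoning

*-estimate : ∀ {K L δ η} a b c e → 0ℚ < K → 0ℚ < L → abs a ≤ K → abs e ≤ L →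
             abs (b - e) < δ → abs (a - c) < η →
             abs (a ℚ.* b - c ℚ.* e) < K ℚ.* δ ℚ.+ L ℚ.* η
*-estimate {K} {L} {δ} {η} a b c e 0<K 0<L a≤K e≤L b-e<δ a-c<η = begin-strict
  abs (a ℚ.* b - c ℚ.* e)                        ≡⟨ cong abs (*-rearrange a b c e) ⟩
  abs (a ℚ.* (b - e) ℚ.+ e ℚ.* (a - c))          ≤⟨ ℚ.∣p+q∣≤∣p∣+∣q∣ (a ℚ.* (b - e)) (e ℚ.* (a - c)) ⟩
  abs (a ℚ.* (b - e)) ℚ.+ abs (e ℚ.* (a - c))    <⟨ ℚ.+-mono-< (*-bound a (b - e) 0<K a≤K b-e<δ)
                                                               (*-bound e (a - c) 0<L e≤L a-c<η) ⟩
  K ℚ.* δ ℚ.+ L ℚ.* η                            ∎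
  where
  open ℚ.≤-Reasoning

*-cauchy : ∀ {x y} → IsCauchy x → IsCauchy y → IsCauchy (λ n → x n ℚ.* y n)
*-cauchy {x} {y} cx cy ε 0<ε = go (bounded cx) (bounded cy)
  where
  go : EventuallyBounded x → EventuallyBounded y →
       ∃[ N ] ∀ m n → N ℕ.≤ m → N ℕ.≤ n → abs (x m ℚ.* y m - x n ℚ.* y n) < ε
  go (K , M , 0<K , x≤K) (L , N , 0<L , y≤L) =
    choose (divide-ε 0<K (half>0 0<ε)) (divide-ε 0<L (half>0 0<ε))
    where
    choose : ∃[ δ ] 0ℚ < δ × K ℚ.* δ ≡ ½ ℚ.* ε → ∃[ η ] 0ℚ < η × L ℚ.* η ≡ ½ ℚ.* ε →
             ∃[ N ] ∀ m n → N ℕ.≤ m → N ℕ.≤ n → abs (x m ℚ.* y m - x n ℚ.* y n) < ε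
    choose (δ , 0<δ , Kδ≡) (η , 0<η , Lη≡) = R , close
      where
      P = proj₁ (cy δ 0<δ)
      Q = proj₁ (cx η 0<η)
      R = (M ℕ.⊔ N) ℕ.⊔ (P ℕ.⊔ Q)

      M≤R : M ℕ.≤ R
      M≤R = ℕ.≤-trans (ℕ.m≤m⊔n M N) (ℕ.m≤m⊔n (M ℕ.⊔ N) (P ℕ.⊔ Q))

      N≤R : N ℕ.≤ R
      N≤R = ℕ.≤-trans (ℕ.m≤n⊔m M N) (ℕ.m≤m⊔n (M ℕ.⊔ N) (P ℕ.⊔ Q))

      P≤R : P ℕ.≤ R
      P≤R = ℕ.≤-trans (ℕ.m≤m⊔n P Q) (ℕ.m≤n⊔m (M ℕ.⊔ N) (P ℕ.⊔ Q))

      Q≤R : Q ℕ.≤ R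
      Q≤R = ℕ.≤-trans (ℕ.m≤n⊔m P Q) (ℕ.m≤n⊔m (M ℕ.⊔ N) (P ℕ.⊔ Q))

      close : ∀ m n → R ℕ.≤ m → R ℕ.≤ n → abs (x m ℚ.* y m - x n ℚ.* y n) < ε
      close m n p q = subst (abs (x m ℚ.* y m - x n ℚ.* y n) <_)
        (trans (cong₂ ℚ._+_ Kδ≡ Lη≡) (half+half ε))
        (*-estimate (x m) (y m) (x n) (y n) 0<K 0<L
          (x≤K m (ℕ.≤-trans M≤R p)) (y≤L n (ℕ.≤-trans N≤R q))
          (proj₂ (cy δ 0<δ) m n (ℕ.≤-trans P≤R p) (ℕ.≤-trans P≤R q))
          (proj₂ (cx η 0<η) m n (ℕ.≤-trans Q≤R p) (ℕ.≤-trans Q≤R q)))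

infixl 6 _+_
infixl 7 _*_

fromℚ : ℚ → ℝ
fromℚ q = mkℝ (λ _ → q) (const-cauchy q)

0ℝ 1ℝ : ℝ
0ℝ = fromℚ 0ℚ
1ℝ = fromℚ 1ℚ

_+_ _*_ : ℝ → ℝ → ℝ
x + y = mkℝ (λ n → seq x n ℚ.+ seq y n) (+-cauchy {seq x} {seq y} (cauchy x) (cauchy y))
x * y = mkℝ (λ n → seq x n ℚ.* seq y n) (*-cauchy {seq x} {seq y} (cauchy x) (cauchy y))

infix 8 ℝ^_
infix 4 _≋_

ℝ^_ : ℕ → Set
ℝ^ d = Vector ℝ d

_≋_ : Rel (ℝ^ d) _
_≋_ = Pointwise _≈_

∑ : ∀ {k} → Vector ℝ k → ℝ
∑ = foldr _+_ 0ℝ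

⟨_,_⟩ : ℝ^ d → ℝ^ d → ℝ
⟨ a , b ⟩ = ∑ (zipWith _*_ a b)

linearCombination : ∀ {k} → Vector ℝ k → Vector (ℝ^ d) k → ℝ^ d
linearCombination c v i = ∑ (λ j → c j * v j i)

span : Pred (ℝ^ d) ℓ → Pred (ℝ^ d) ℓ
span {d} X u =
  ∃[ k ] Σ[ c ∈ Vector ℝ k ] Σ[ v ∈ Vector (ℝ^ d) k ]
    (∀ j → v j ∈ X) × u ≋ linearCombination c v

Spans : Pred (ℝ^ d) ℓ → Set ℓ
Spans X = ∀ u → u ∈ span X

infix 4 _≤#_

-- m ≤# X says m ≤ |X|: there is an injection from an m-element set into X,
-- and elements of X are counted up to _≋_.
_≤#_ : ℕ → Pred (ℝ^ d) ℓ → Set ℓ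
_≤#_ {d} m X = Σ[ f ∈ (Fin m → ℝ^ d) ] (∀ i → f i ∈ X) × Injective _≡_ _≋_ f

-- |X| · |Y| ≤ N.  X and Y are not assumed finite, and a subset of a finite set
-- need not have a computable number of elements, so the bound is imposed on
-- all natural numbers m ≤ |X| and n ≤ |Y|.
∣_∣·∣_∣≤_ : ∀ {ℓ₁ ℓ₂} → Pred (ℝ^ d) ℓ₁ → Pred (ℝ^ d) ℓ₂ → ℕ → Set (ℓ₁ ⊔ ℓ₂)
∣ X ∣·∣ Y ∣≤ N = ∀ m n → m ≤# X → n ≤# Y → m ℕ.* n ℕ.≤ N

{-# OPTIONS --safe #-}

-- Add a zero row to the 0/1 matrix of the products ⟨ a , b ⟩ and argue by
-- induction on the rank d. Let b be a nonzero column. Adding a row to all rows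
-- modulo 2 exchanges that row with the zero row, so that we may assume that b
-- vanishes on at least half of the rows. Enlarge {b = 0} to the zero set A₀ of a
-- function v in the span of the columns and the constants until any difference
-- of columns that vanishes on A₀ and on one further row vanishes on all rows, and
-- likewise for differences of such differences. Distinct columns that are equal
-- on A₀ are then complementary on the remaining rows A₁, so at most two columns
-- share their restriction to A₀. Let R be a set of representatives of the
-- restrictions and D the set of those attained twice. By induction
-- |A₀| |R| ≤ d 2^(d-1). Up to complements the columns of D agree on A₁, whence
-- |A₁| |D| ≤ 2^(d-1) by a dimension count. As |A₁| ≤ |A₀| and |D| ≤ |R|, the
-- rearrangement inequality gives
-- |A| |B| = (|A₀| + |A₁|) (|R| + |D|) ≤ 2 (|A₀| |R| + |A₁| |D|) ≤ (d + 1) 2^d.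
--
-- The rank is accessed only through the lengths of triangular systems with
-- rational entries. Real numbers enter in a single place, the bound of these
-- lengths by the dimension, for which apartness from zero suffices.

module Submission where

open import Algebra.Bundles using (CommutativeRing)
import Algebra.Properties.Group as GroupProperties
import Algebra.Properties.Ring as RingProperties
import Algebra.Properties.Semiring.Sum as SemiringSum
open import Algebra.Structures using (IsGroup; IsRing)
open import Data.Bool.Base using (Bool; true; false; _xor_)
import Data.Bool.Properties as Bool
open import Data.Empty using (⊥)
open import Data.Fin.Base as Fin using (Fin; punchIn)
import Data.Fin.Properties as Fin
open import Data.List.Base
  using (List; []; _∷_; _++_; length; map; concat; tabulate; filter; reverse; lookup; cartesianProductWith)
open import Data.List.Membership.Propositional using (find; lose) renaming (_∈_ to _∈ˡ_)
open import Data.List.Membership.Propositional.Properties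
  using (∈-filter⁺; ∈-filter⁻; ∈-map⁺; ∈-map⁻; ∈-++⁺ˡ; ∈-++⁺ʳ; ∈-cartesianProductWith⁺; ∈-lookup)
import Data.List.Properties as List
open import Data.List.Relation.Unary.All as All using (All; []; _∷_; all?)
import Data.List.Relation.Unary.All.Properties as All
open import Data.List.Relation.Unary.AllPairs as AllPairs using (AllPairs; []; _∷_)
import Data.List.Relation.Unary.AllPairs.Properties as AllPairs
open import Data.List.Relation.Unary.Any as Any using (Any; here; there; any?)
import Data.List.Relation.Unary.Any.Properties as Any
open import Data.Maybe.Base using (Maybe; just; nothing)
open import Data.Nat.Base as ℕ using (ℕ; zero; suc; z≤n; s≤s)
import Data.Nat.Properties as ℕ
import Data.Nat.Solver as ℕSolver
open import Data.Product.Base using (Σ; Σ-syntax; ∃; ∃₂; ∃-syntax; _×_; _,_; proj₁; proj₂)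
open import Data.Rational.Base as ℚ using (ℚ; 0ℚ; 1ℚ; ½)
import Data.Rational.Properties as ℚ
import Data.Rational.Solver as ℚSolver
open import Data.Sum.Base as Sum using (_⊎_; inj₁; inj₂)
open import Data.Vec.Functional as Vec using (Vector; removeAt; zipWith)
import Defs
open import Function.Base using (_∘_; flip)
open import Level using (Level; 0ℓ; _⊔_) renaming (suc to lsuc)
open import Relation.Binary.Core using (Rel)
open import Relation.Binary.Definitions using (Symmetric; Transitive; _Respects_)
open import Relation.Binary.PropositionalEquality as ≡
  using (_≡_; _≢_; _≗_; subst; cong; cong₂)
import Relation.Binary.Reasoning.Setoid as SetoidReasoning
open import Relation.Binary.Structures using (IsEquivalence)
open import Relation.Nullary using (¬_; Dec; yes; no; contradiction)
open import Relation.Nullary.Decidable using (¬?; _×-dec_; _→-dec_; map′)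
open import Relation.Unary using (Pred; Decidable; _∈_)

module Combinatorics where

  open import Data.Nat.Base using (_+_; _*_; _^_; _≤_)
  open import Data.Rational.Base using (_-_)
  open ≡ using (refl; sym; trans)

  private
    variable
      a b p q r : Level
      A : Set a
      B : Set b

  -- Bits and finite lists.

  bool-pigeonhole : ∀ {x y z : Bool} → x ≢ y → y ≢ z → x ≢ z → ⊥
  bool-pigeonhole {true}  {true}  {_}     x≢y _ _ = x≢y refl
  bool-pigeonhole {true}  {false} {true}  _ _ x≢z = x≢z refl
  bool-pigeonhole {true}  {false} {false} _ y≢z _ = y≢z refl
  bool-pigeonhole {false} {false} {_}     x≢y _ _ = x≢y refl
  bool-pigeonhole {false} {true}  {true}  _ y≢z _ = y≢z refl
  bool-pigeonhole {false} {true}  {false} _ _ x≢z = x≢z refl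

  xor-cancelʳ : ∀ {x y} z → x xor z ≡ y xor z → x ≡ y
  xor-cancelʳ {true}  {true}  _     _  = refl
  xor-cancelʳ {false} {false} _     _  = refl
  xor-cancelʳ {true}  {false} true  ()
  xor-cancelʳ {true}  {false} false ()
  xor-cancelʳ {false} {true}  true  ()
  xor-cancelʳ {false} {true}  false ()

  module _ {P : Pred A p} (P? : Decidable P) where

    length-filter-¬ : ∀ xs → length (filter P? xs) + length (filter (¬? ∘ P?) xs) ≡ length xs
    length-filter-¬ []       = refl
    length-filter-¬ (x ∷ xs) with P? x
    ... | yes _ = cong suc (length-filter-¬ xs)
    ... | no _  = trans (ℕ.+-suc _ _) (cong suc (length-filter-¬ xs))

    length-filter-mono : ∀ {Q : Pred A q} (Q? : Decidable Q) {xs} → All (λ x → P x → Q x) xs →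
                         length (filter P? xs) ≤ length (filter Q? xs)
    length-filter-mono Q? {[]}     []        = z≤n
    length-filter-mono Q? {x ∷ xs} (f ∷ fs) with P? x | Q? x
    ... | yes _  | yes _  = s≤s (length-filter-mono Q? fs)
    ... | yes px | no ¬qx = contradiction (f px) ¬qx
    ... | no _   | yes _  = ℕ.m≤n⇒m≤1+n (length-filter-mono Q? fs)
    ... | no _   | no _   = length-filter-mono Q? fs

  AllPairs-map-∈ : ∀ {R : Rel A r} {S : Rel A q} {xs} → (∀ {x y} → x ∈ˡ xs → y ∈ˡ xs → R x y → S x y) →
                   AllPairs R xs → AllPairs S xs
  AllPairs-map-∈ f []       = []
  AllPairs-map-∈ f (h ∷ hs) =
    All.tabulate (λ y∈xs → f (here refl) (there y∈xs) (All.lookup h y∈xs)) ∷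
    AllPairs-map-∈ (λ x∈xs y∈xs → f (there x∈xs) (there y∈xs)) hs

  reverse⁺ : ∀ {R : Rel A r} {xs} → AllPairs (flip R) xs → AllPairs R (reverse xs)
  reverse⁺ []                        = []
  reverse⁺ {R = R} {x ∷ xs} (h ∷ hs) = subst (AllPairs R) (sym (List.unfold-reverse x xs))
    (AllPairs.++⁺ (reverse⁺ hs) ([] ∷ [])
      (All.tabulate λ y∈ → All.lookup h (Any.reverse⁻ y∈) ∷ []))

  lookup-AllPairs : ∀ {R : Rel A r} {xs} → AllPairs R xs → ∀ {i j} → i Fin.< j →
                    R (lookup xs i) (lookup xs j)
  lookup-AllPairs {xs = _ ∷ xs} (h ∷ _)  {Fin.zero}  {Fin.suc j} _         = All.lookup h (∈-lookup {xs = xs} j)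
  lookup-AllPairs               (_ ∷ hs) {Fin.suc _} {Fin.suc _} (s≤s i<j) = lookup-AllPairs hs i<j

  -- Representatives of equivalence classes, and classes of two elements.

  length-≤-representatives : ∀ {_~_ : Rel A r} → Symmetric _~_ → Transitive _~_ → ∀ {xs ys} →
    AllPairs (λ x y → ¬ x ~ y) xs → All (λ x → Any (x ~_) ys) xs → length xs ≤ length ys
  length-≤-representatives {_~_ = _~_} ~-sym ~-trans {xs} {ys} distinct covered =
    ℕ.≮⇒≥ λ ys<xs → collide (Fin.pigeonhole ys<xs (λ i → Any.index (rep i)))
    where
    rep : ∀ i → Any (lookup xs i ~_) ys
    rep i = All.lookup covered (∈-lookup {xs = xs} i)

    collide : ∃₂ (λ i j → i Fin.< j × Any.index (rep i) ≡ Any.index (rep j)) → ⊥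
    collide (i , j , i<j , eq) = lookup-AllPairs distinct i<j
      (~-trans (Any.lookup-index (rep i))
               (~-sym (subst (λ k → lookup xs j ~ lookup ys k) (sym eq) (Any.lookup-index (rep j)))))

  module _ {_~_ : Rel A r} (~-refl : ∀ {x} → x ~ x) (_~?_ : ∀ x y → Dec (x ~ y)) where

    -- Greedy choice: an element of `ys` is added only if nothing kept so far represents it. The
    -- distinct elements of `xs` all survive, so the length never drops.
    extend : ∀ xs ys → AllPairs (λ x y → ¬ x ~ y) xs →
             ∃[ zs ] AllPairs (λ x y → ¬ x ~ y) zs × length xs ≤ length zs ×
                     All (λ x → Any (x ~_) zs) (ys ++ xs)
    extend xs []       distinct = xs , distinct , ℕ.≤-refl , All.tabulate (Any.map λ { refl → ~-refl })
    extend xs (y ∷ ys) distinct with extend xs ys distinct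
    ... | zs , zs-distinct , xs≤zs , covered with any? (y ~?_) zs
    ...   | yes y~zs = zs , zs-distinct , xs≤zs , y~zs ∷ covered
    ...   | no  y≁zs = y ∷ zs , All.¬Any⇒All¬ zs y≁zs ∷ zs-distinct , ℕ.m≤n⇒m≤1+n xs≤zs ,
                       here ~-refl ∷ All.map there covered

  -- The lists R and D of the induction: `reps` holds one element of each class of `_~_`, and
  -- `pairs` one pair for each class with two elements. The length splits because such a class is
  -- counted once in each list.
  record Pairing {A : Set a} (_~_ : Rel A r) (_#_ : Rel A q) (xs : List A) : Set (a ⊔ r ⊔ q) where
    field
      reps           : List A
      pairs          : List (A × A)
      length-split   : length xs ≡ length reps + length pairs
      reps-⊆         : All (_∈ˡ xs) reps
      pairs-⊆        : All (λ (x , y) → x ∈ˡ xs × y ∈ˡ xs × x # y × x ~ y) pairs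
      reps-distinct  : AllPairs (λ x y → ¬ x ~ y) reps
      pairs-distinct : AllPairs (λ (x , _) (y , _) → ¬ x ~ y) pairs
      reps-cover     : All (λ x → Any (x ~_) reps) xs

  module _ {_~_ : Rel A r} {_#_ : Rel A q}
           (~-refl : ∀ {x} → x ~ x) (~-trans : Transitive _~_) (_~?_ : ∀ x y → Dec (x ~ y)) where

    pairUp : ∀ xs → AllPairs _#_ xs →
             (∀ {x y z} → x ∈ˡ xs → y ∈ˡ xs → z ∈ˡ xs → x # y → y # z → x # z → x ~ y → y ~ z → ⊥) →
             Pairing _~_ _#_ xs
    pairUp [] [] _ = record
      { reps = [] ; pairs = [] ; length-split = refl ; reps-⊆ = [] ; pairs-⊆ = []
      ; reps-distinct = [] ; pairs-distinct = [] ; reps-cover = [] }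
    pairUp (x ∷ xs) (x#xs ∷ distinct) no-triple
      with pairUp xs distinct (λ i j k → no-triple (there i) (there j) (there k)) | any? (x ~?_) xs
    ... | rec | no x≁xs = record
      { reps           = x ∷ reps
      ; pairs          = pairs
      ; length-split   = cong suc length-split
      ; reps-⊆         = here refl ∷ All.map there reps-⊆
      ; pairs-⊆        = All.map (λ (i , j , h) → there i , there j , h) pairs-⊆
      ; reps-distinct  = All.map (All.lookup (All.¬Any⇒All¬ xs x≁xs)) reps-⊆ ∷ reps-distinct
      ; pairs-distinct = pairs-distinct
      ; reps-cover     = here ~-refl ∷ All.map there reps-cover
      }
      where open Pairing rec
    ... | rec | yes x~xs = record
      { reps           = reps
      ; pairs          = (x , y) ∷ pairs
      ; length-split   = trans (cong suc length-split) (sym (ℕ.+-suc _ _))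
      ; reps-⊆         = All.map there reps-⊆
      ; pairs-⊆        = (here refl , there y∈xs , All.lookup x#xs y∈xs , x~y) ∷
                         All.map (λ (i , j , h) → there i , there j , h) pairs-⊆
      ; reps-distinct  = reps-distinct
      -- If `x` were also related to the first entry of another pair, then `x` and the two entries
      -- of that pair would form a forbidden triple.
      ; pairs-distinct = All.map (λ (i , j , z#z′ , z~z′) x~z →
                             no-triple (here refl) (there i) (there j)
                               (All.lookup x#xs i) z#z′ (All.lookup x#xs j) x~z z~z′) pairs-⊆
                         ∷ pairs-distinct
      ; reps-cover     = Any.map (~-trans x~y) (All.lookup reps-cover y∈xs) ∷ reps-cover
      }
      where
      open Pairing rec
      y    = Any.lookup x~xs
      y∈xs = ∈-lookup {xs = xs} (Any.index x~xs)
      x~y  = Any.lookup-index x~xs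

  -- Triangular systems extracted from a matrix of bits.

  module _ {U : Set a} {V : Set b} (test : U → V → Bool) where

    Differ : List V → Rel U b
    Differ vs x y = Any (λ v → test x v ≢ test y v) vs

    -- A formal difference `left - right` with a test at which it is nonzero, to serve as a diagonal
    -- entry of a triangular system.
    record Difference (us : List U) (vs : List V) : Set (a ⊔ b) where
      constructor difference
      field
        {left right} : U
        {at}         : V
        left∈        : left ∈ˡ us
        right∈       : right ∈ˡ us
        at∈          : at ∈ˡ vs
        differ       : test left at ≢ test right at

    VanishesAt : ∀ {us vs} → V → Difference us vs → Set
    VanishesAt v e = test left v ≡ test right v
      where open Difference e

    Triangular : ∀ {us vs} → Rel (Difference us vs) _
    Triangular d e = VanishesAt (Difference.at d) e

    weaken : ∀ {us us′ v vs} → (∀ {u} → u ∈ˡ us′ → u ∈ˡ us) → Difference us′ vs → Difference us (v ∷ vs)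
    weaken f (difference l r i d) = difference (f l) (f r) (there i) d

    -- Each test that separates two members of the family is paired with their
    -- difference; continuing with the larger half, on which the test is constant,
    -- makes the system triangular.
    bisect : ∀ us vs → AllPairs (Differ vs) us →
             ∃[ es ] AllPairs (Triangular {us} {vs}) es × length us ≤ 2 ^ length es
    bisect []          []       _                = [] , [] , z≤n
    bisect (_ ∷ [])    []       _                = [] , [] , ℕ.≤-refl
    bisect (_ ∷ _ ∷ _) []       ((() ∷ _) ∷ _)
    bisect us          (v ∷ vs) distinct = go (pos , refl) (neg , refl)
      where
      on? : Decidable (λ u → test u v ≡ true)
      on? u = test u v Bool.≟ true

      pos = filter on? us
      neg = filter (¬? ∘ on?) us

      half : ∀ {us′} t → (∀ {u} → u ∈ˡ us′ → u ∈ˡ us × test u v ≡ t) → AllPairs (Differ (v ∷ vs)) us′ →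
             ∃[ es ] AllPairs (Triangular {us} {v ∷ vs}) es × All (VanishesAt v) es ×
                     length us′ ≤ 2 ^ length es
      half {us′} t us′⊆ dist with bisect us′ vs (AllPairs-map-∈ drop dist)
        where
        drop : ∀ {x y} → x ∈ˡ us′ → y ∈ˡ us′ → Differ (v ∷ vs) x y → Differ vs x y
        drop x∈ y∈ (here x≢y)  = contradiction (trans (proj₂ (us′⊆ x∈)) (sym (proj₂ (us′⊆ y∈)))) x≢y
        drop x∈ y∈ (there x≢y) = x≢y
      ... | es , tri , bound =
        map (weaken (proj₁ ∘ us′⊆)) es , AllPairs.map⁺ (AllPairs.map (λ z → z) tri) ,
        All.map⁺ (All.universal (λ (difference l r _ _) → trans (proj₂ (us′⊆ l)) (sym (proj₂ (us′⊆ r)))) es) ,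
        subst (λ k → length us′ ≤ 2 ^ k) (sym (List.length-map (weaken (proj₁ ∘ us′⊆)) es)) bound

      pos⊆ : ∀ {u} → u ∈ˡ pos → u ∈ˡ us × test u v ≡ true
      pos⊆ = ∈-filter⁻ on?

      neg⊆ : ∀ {u} → u ∈ˡ neg → u ∈ˡ us × test u v ≡ false
      neg⊆ u∈ with ∈-filter⁻ (¬? ∘ on?) {xs = us} u∈
      ... | u∈us , u≢true = u∈us , Bool.¬-not u≢true

      pos-half = half true pos⊆ (AllPairs.filter⁺ on? distinct)
      neg-half = half false neg⊆ (AllPairs.filter⁺ (¬? ∘ on?) distinct)

      go : ∃[ l ] pos ≡ l → ∃[ l ] neg ≡ l →
           ∃[ es ] AllPairs (Triangular {us} {v ∷ vs}) es × length us ≤ 2 ^ length es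
      go ([] , pos≡) _ = let es , tri , _ , bound = neg-half in
        es , tri , subst (_≤ 2 ^ length es)
          (trans (cong (λ l → length l + length neg) (sym pos≡)) (length-filter-¬ on? us)) bound
      go (_ , _) ([] , neg≡) = let es , tri , _ , bound = pos-half in
        es , tri , subst (_≤ 2 ^ length es)
          (trans (sym (ℕ.+-identityʳ _))
                 (trans (cong (λ l → length pos + length l) (sym neg≡)) (length-filter-¬ on? us))) bound
      go (x ∷ _ , pos≡) (y ∷ _ , neg≡) = larger (ℕ.≤-total (length neg) (length pos))
        where
        x∈ = pos⊆ (subst (x ∈ˡ_) (sym pos≡) (here refl))
        y∈ = neg⊆ (subst (y ∈ˡ_) (sym neg≡) (here refl))

        e : Difference us (v ∷ vs)
        e = difference (proj₁ x∈) (proj₁ y∈) (here refl)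
              λ eq → contradiction (trans (sym (proj₂ x∈)) (trans eq (proj₂ y∈))) λ ()

        larger : length neg ≤ length pos ⊎ length pos ≤ length neg →
                 ∃[ es ] AllPairs (Triangular {us} {v ∷ vs}) es × length us ≤ 2 ^ length es
        larger (inj₁ neg≤pos) = let es , tri , van , bound = pos-half in
          e ∷ es , van ∷ tri , (begin
            length us                       ≡⟨ length-filter-¬ on? us ⟨
            length pos + length neg         ≤⟨ ℕ.+-mono-≤ bound (ℕ.≤-trans neg≤pos bound) ⟩
            2 ^ length es + 2 ^ length es   ≡⟨ cong (2 ^ length es +_) (ℕ.+-identityʳ _) ⟨
            2 ^ suc (length es)             ∎)
          where open ℕ.≤-Reasoning
        larger (inj₂ pos≤neg) = let es , tri , van , bound = neg-half in
          e ∷ es , van ∷ tri , (begin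
            length us                       ≡⟨ length-filter-¬ on? us ⟨
            length pos + length neg         ≤⟨ ℕ.+-mono-≤ (ℕ.≤-trans pos≤neg bound) bound ⟩
            2 ^ length es + 2 ^ length es   ≡⟨ cong (2 ^ length es +_) (ℕ.+-identityʳ _) ⟨
            2 ^ suc (length es)             ∎)
          where open ℕ.≤-Reasoning

  -- Enlarging a matrix so that its rows and its columns are distinct.

  module _ {U : Set a} {V : Set b} (test : U → V → Bool) where

    Agree : List V → Rel U b
    Agree vs x y = All (λ v → test x v ≡ test y v) vs

    agree? : ∀ vs x y → Dec (Agree vs x y)
    agree? vs x y = all? (λ v → test x v Bool.≟ test y v) vs

    ¬Agree⇒Differ : ∀ {vs x y} → ¬ Agree vs x y → Differ test vs x y
    ¬Agree⇒Differ {vs} {x} {y} = All.¬All⇒Any¬ (λ v → test x v Bool.≟ test y v) vs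

    Differ⇒¬Agree : ∀ {vs x y} → Differ test vs x y → ¬ Agree vs x y
    Differ⇒¬Agree differ agree = All.All¬⇒¬Any (All.map (λ eq x≢y → x≢y eq) agree) differ

  module _ {U : Set a} {V : Set b} (test : U → V → Bool) where

    -- A separating test may be exchanged for its representative in `ws`, which takes the same
    -- values on `us`.
    covered-differ : ∀ {us vs ws} → All (λ v → Any (Agree (flip test) us v) ws) vs →
                     ∀ {x y} → x ∈ˡ us → y ∈ˡ us → Differ test vs x y → Differ test ws x y
    covered-differ covered x∈ y∈ differ with find differ
    ... | v , v∈ , x≢y with find (All.lookup covered v∈)
    ...   | w , w∈ , v~w = lose w∈ λ eq →
      x≢y (trans (All.lookup v~w x∈) (trans eq (sym (All.lookup v~w y∈))))

  module _ {U : Set a} {V : Set b} (test : U → V → Bool) where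

    record Adjoined (us : List U) (vs vs′ : List V) : Set (a ⊔ b) where
      field
        {us⁺}       : List U
        {vs⁺}       : List V
        us≤us⁺      : length us ≤ length us⁺
        vs≤vs⁺      : length vs ≤ length vs⁺
        us-distinct : AllPairs (Differ test vs⁺) us⁺
        vs-distinct : AllPairs (Differ (flip test) us⁺) vs⁺
        vs-covered  : All (λ v → Any (Agree (flip test) us⁺ v) vs⁺) (vs′ ++ vs)

    -- The members of `us` may be separated only by tests from `vs′`, and those of `vs` only by
    -- members of `us′`, so both lists are enlarged. Representatives are chosen to avoid duplicates,
    -- first for `us`, then for `vs`; by `covered-differ` neither choice destroys the separation on
    -- the other side.
    adjoin : ∀ us us′ vs vs′ →
      AllPairs (Differ test (vs′ ++ vs)) us → AllPairs (Differ (flip test) (us′ ++ us)) vs →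
      Adjoined us vs vs′
    adjoin us us′ vs vs′ us-distinct vs-distinct
      with extend (All.universal (λ _ → refl) _) (agree? test (vs′ ++ vs)) us us′
             (AllPairs.map (Differ⇒¬Agree test) us-distinct)
    ... | us⁺ , us⁺-distinct , us≤ , us-covered
      with extend (All.universal (λ _ → refl) _) (agree? (flip test) us⁺) vs vs′
             (AllPairs.map (Differ⇒¬Agree (flip test))
               (AllPairs-map-∈ (λ x∈ y∈ →
                 covered-differ (flip test) us-covered (∈-++⁺ʳ vs′ x∈) (∈-++⁺ʳ vs′ y∈)) vs-distinct))
    ...   | vs⁺ , vs⁺-distinct , vs≤ , vs-covered = record
      { us≤us⁺      = us≤
      ; vs≤vs⁺      = vs≤
      ; us-distinct = AllPairs-map-∈ (λ x∈ y∈ → covered-differ test vs-covered x∈ y∈)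
                        (AllPairs.map (¬Agree⇒Differ test) us⁺-distinct)
      ; vs-distinct = AllPairs.map (¬Agree⇒Differ (flip test)) vs⁺-distinct
      ; vs-covered  = vs-covered
      }

  -- Bits as rational numbers.

  ⌊_⌋ : Bool → ℚ
  ⌊ false ⌋ = 0ℚ
  ⌊ true ⌋  = 1ℚ

  ⌊⌋-injective : ∀ {x y} → ⌊ x ⌋ ≡ ⌊ y ⌋ → x ≡ y
  ⌊⌋-injective {false} {false} _ = refl
  ⌊⌋-injective {true}  {true}  _ = refl
  ⌊⌋-injective {false} {true}  ()
  ⌊⌋-injective {true}  {false} ()

  ⌊⌋-difference-zero : ∀ {x y} → x ≡ y → ⌊ x ⌋ - ⌊ y ⌋ ≡ 0ℚ
  ⌊⌋-difference-zero {x} refl = ℚ.+-inverseʳ ⌊ x ⌋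

  ⌊⌋-difference-zero⁻ : ∀ {x y} → ⌊ x ⌋ - ⌊ y ⌋ ≡ 0ℚ → x ≡ y
  ⌊⌋-difference-zero⁻ {false} {false} _ = refl
  ⌊⌋-difference-zero⁻ {true}  {true}  _ = refl
  ⌊⌋-difference-zero⁻ {false} {true}  ()
  ⌊⌋-difference-zero⁻ {true}  {false} ()

  -- A gap between distinct bits is 1 or -1, and its sign determines the bit from which it starts.
  ⌊⌋-equal-gaps : ∀ {x x′ y y′} → x ≢ x′ → y ≢ y′ → (⌊ x′ ⌋ - ⌊ x ⌋) - (⌊ y′ ⌋ - ⌊ y ⌋) ≡ 0ℚ → x ≡ y
  ⌊⌋-equal-gaps {false} {_}     {false} {_}     _ _ _ = refl
  ⌊⌋-equal-gaps {true}  {_}     {true}  {_}     _ _ _ = refl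
  ⌊⌋-equal-gaps {false} {false} {true}  {_}     x≢x′ _ _ = contradiction refl x≢x′
  ⌊⌋-equal-gaps {false} {true}  {true}  {true}  _ y≢y′ _ = contradiction refl y≢y′
  ⌊⌋-equal-gaps {false} {true}  {true}  {false} _ _ ()
  ⌊⌋-equal-gaps {true}  {true}  {false} {_}     x≢x′ _ _ = contradiction refl x≢x′
  ⌊⌋-equal-gaps {true}  {false} {false} {false} _ y≢y′ _ = contradiction refl y≢y′
  ⌊⌋-equal-gaps {true}  {false} {false} {true}  _ _ ()

  length-trivial : ∀ {a r} {A : Set a} {R : Rel A r} {xs} → AllPairs R xs →
                   (∀ {x y} → x ∈ˡ xs → y ∈ˡ xs → ¬ R x y) → length xs ≤ 1
  length-trivial []                        _  = z≤n
  length-trivial (_ ∷ [])                  _  = ℕ.≤-refl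
  length-trivial ((Rxy ∷ _) ∷ (_ ∷ _)) ¬R = contradiction Rxy (¬R (here refl) (there (here refl)))

  -- Function spaces, affine rank and the dimension count.

  record FunctionSpace {a} (X : Set a) p : Set (a ⊔ lsuc p) where
    field
      Mem   : Pred (X → ℚ) p
      resp  : ∀ {e f} → e ≗ f → Mem e → Mem f
      const : ∀ q → Mem (λ _ → q)
      -- Together with `const` this makes `Mem` a group under addition: sums arise as `e - (0 - f)`.
      sub   : ∀ {e f} → Mem e → Mem f → Mem (λ x → e x - f x)

  module _ {a p} {X : Set a} (S : FunctionSpace X p) where
    open FunctionSpace S

    record Column : Set (a ⊔ p) where
      field
        val : X → Bool
        mem : Mem (⌊_⌋ ∘ val)
    open Column

    -- The affine counterpart of `Difference`: a diagonal entry formed by a difference of two rows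
    -- and a function of the space.
    record Pivot : Set (a ⊔ p) where
      field
        left right : X
        fun        : X → ℚ
        mem        : Mem fun
        nonzero    : fun left ≢ fun right

    Within : List X → Pred Pivot a
    Within A p = left ∈ˡ A × right ∈ˡ A
      where open Pivot p

    _⊥ᵖ_ : Rel Pivot _
    p ⊥ᵖ q = Pivot.fun q (Pivot.left p) ≡ Pivot.fun q (Pivot.right p)

    -- The affine rank of the rows A, tested by triangular systems with nonzero
    -- diagonal whose rows are differences of elements of A.
    RankAtMost : List X → ℕ → Set (a ⊔ p)
    RankAtMost A d = ∀ L → All (Within A) L → AllPairs _⊥ᵖ_ L → length L ≤ d

    DistinctRows : List Column → List X → Set (a ⊔ p)
    DistinctRows B = AllPairs (Differ (flip val) B)

    DistinctColumns : List X → List Column → Set (a ⊔ p)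
    DistinctColumns A = AllPairs (Differ val A)

    gap : Column → Column → ∃ Mem
    gap b c = _ , sub (mem b) (mem c)

    gap₂ : ∃ Mem → ∃ Mem → ∃ Mem
    gap₂ (_ , e) (_ , f) = _ , sub e f

    -- Translation of the rows by the row `o` modulo 2. On a single column this is the identity or
    -- the complement `1 - c`, so the column stays in the same function space and the same rank
    -- bound applies.
    flipAt : X → Column → Column
    flipAt o c .val x = val c x xor val c o
    flipAt o c .mem with val c o
    ... | false = resp (λ x → cong ⌊_⌋ (sym (Bool.xor-identityʳ (val c x)))) (mem c)
    ... | true  = resp (λ x → complement (val c x)) (sub (const 1ℚ) (mem c))
      where
      complement : ∀ t → 1ℚ - ⌊ t ⌋ ≡ ⌊ t xor true ⌋
      complement true  = refl
      complement false = refl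

    module _ {A : List X} {o : X} (o∈A : o ∈ˡ A) where

      -- A triangular system on the zero set of `u` can be prolonged at its end by the pivot with
      -- rows `i`, `o` and function `u`, because `u` vanishes on all differences of rows from its
      -- zero set.
      rank-zeroes : ∀ {d u} → Mem u → u o ≡ 0ℚ → Any (λ i → u i ≢ 0ℚ) A → RankAtMost A (suc d) →
                    RankAtMost (filter (λ i → u i ℚ.≟ 0ℚ) A) d
      rank-zeroes {d} {u} Mu uo≡0 nz rank L within tri with find nz
      ... | i , i∈A , ui≢0 = ℕ.≤-pred (subst (_≤ suc d)
        (trans (List.length-++ L) (ℕ.+-comm (length L) 1))
        (rank (L ++ pivot ∷ [])
          (All.++⁺ (All.map (λ (l , r) → proj₁ (zero⁻ l) , proj₁ (zero⁻ r)) within) ((i∈A , o∈A) ∷ []))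
          (AllPairs.++⁺ tri ([] ∷ [])
            (All.map (λ (l , r) → trans (proj₂ (zero⁻ l)) (sym (proj₂ (zero⁻ r))) ∷ []) within))))
        where
        zero⁻ : ∀ {j} → j ∈ˡ filter (λ i → u i ℚ.≟ 0ℚ) A → j ∈ˡ A × u j ≡ 0ℚ
        zero⁻ = ∈-filter⁻ (λ i → u i ℚ.≟ 0ℚ)

        pivot : Pivot
        pivot = record { left = i ; right = o ; fun = u ; mem = Mu ; nonzero = λ eq → ui≢0 (trans eq uo≡0) }

      -- The columns of `E` agree on `A₁`, so differences of rows of `A₁` are orthogonal to
      -- differences of columns of `E`. Bisecting both families gives two triangular systems that
      -- can be joined. The function `y` with the row difference `i₁ - o` fits between them; this
      -- extra pivot turns the exponent `d + 1` into `d`.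
      orthogonal-bound : ∀ {d} → RankAtMost A (suc d) →
        ∀ {A₁ B E} → All (_∈ˡ A) A₁ → DistinctRows B A₁ → DistinctColumns A E →
        All (λ c → val c o ≡ false) E →
        (∀ {b c i} → b ∈ˡ E → c ∈ˡ E → i ∈ˡ A₁ → val b i ≡ val c i) →
        ∀ {y t} → Mem y → (∀ {i} → i ∈ˡ A₁ → y i ≡ t) → y o ≢ t →
        length A₁ * length E ≤ 2 ^ d
      orthogonal-bound rank {[]} _ _ _ _ _ _ _ _ = z≤n
      orthogonal-bound {d} rank {A₁@(i₁ ∷ _)} {B} {E} A₁⊆A rows columns vanish agree {y} {t} My y≡t yo≢t
        with bisect (flip val) A₁ B rows | bisect val E A columns
      ... | fs , f-tri , f-bound | es , e-tri , e-bound = begin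
        length A₁ * length E           ≤⟨ ℕ.*-mono-≤ f-bound e-bound ⟩
        2 ^ length fs * 2 ^ length es  ≡⟨ ℕ.^-distribˡ-+-* 2 (length fs) (length es) ⟨
        2 ^ (length fs + length es)    ≤⟨ ℕ.^-monoʳ-≤ 2 (ℕ.≤-pred total) ⟩
        2 ^ d                          ∎
        where
        open ℕ.≤-Reasoning

        rowPivot : Difference (flip val) A₁ B → Pivot
        rowPivot (difference {l} {r} {b} _ _ _ l≢r) = record
          { left = l ; right = r ; fun = ⌊_⌋ ∘ val b ; mem = mem b ; nonzero = l≢r ∘ ⌊⌋-injective }

        yPivot : Pivot
        yPivot = record
          { left = i₁ ; right = o ; fun = y ; mem = My
          ; nonzero = λ eq → yo≢t (trans (sym eq) (y≡t (here refl))) }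

        zero-at-o : ∀ {b c} → b ∈ˡ E → c ∈ˡ E → ⌊ val b o ⌋ - ⌊ val c o ⌋ ≡ 0ℚ
        zero-at-o b∈ c∈ = ⌊⌋-difference-zero (trans (All.lookup vanish b∈) (sym (All.lookup vanish c∈)))

        columnPivot : Difference val E A → Pivot
        columnPivot (difference {b} {c} {i} b∈ c∈ _ b≢c) = record
          { left = i ; right = o ; fun = proj₁ (gap b c) ; mem = proj₂ (gap b c)
          ; nonzero = λ eq → b≢c (⌊⌋-difference-zero⁻ (trans eq (zero-at-o b∈ c∈))) }

        A₁∈A : ∀ {i} → i ∈ˡ A₁ → i ∈ˡ A
        A₁∈A = All.lookup A₁⊆A

        -- In `fs` the later row differences vanish at the earlier columns, whereas `_⊥ᵖ_` asks the
        -- later functions to vanish on the earlier row differences; hence the reversal. The system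
        -- `es` has the right order already.
        L : List Pivot
        L = reverse (map rowPivot fs) ++ yPivot ∷ map columnPivot es

        ∈-rows : ∀ {p} → p ∈ˡ reverse (map rowPivot fs) → ∃[ f ] p ≡ rowPivot f
        ∈-rows p∈ = let f , _ , eq = ∈-map⁻ rowPivot {xs = fs} (Any.reverse⁻ p∈) in f , eq

        within : All (Within A) L
        within = All.++⁺
          (All.tabulate λ p∈ → row-within (∈-rows p∈))
          ((A₁∈A (here refl) , o∈A) ∷
           All.map⁺ (All.universal (λ (difference _ _ i∈ _) → i∈ , o∈A) es))
          where
          row-within : ∀ {p} → ∃[ f ] p ≡ rowPivot f → Within A p
          row-within (difference l r _ _ , refl) = A₁∈A l , A₁∈A r

        i⊥column : ∀ {i} → i ∈ˡ A₁ → ∀ e → Pivot.fun (columnPivot e) i ≡ 0ℚ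
        i⊥column i∈ (difference b∈ c∈ _ _) = ⌊⌋-difference-zero (agree b∈ c∈ i∈)

        column-at-o : ∀ e → Pivot.fun (columnPivot e) o ≡ 0ℚ
        column-at-o (difference b∈ c∈ _ _) = zero-at-o b∈ c∈

        tri : AllPairs _⊥ᵖ_ L
        tri = AllPairs.++⁺
          (reverse⁺ (AllPairs.map⁺ (AllPairs.map (cong ⌊_⌋) f-tri)))
          (All.map⁺ (All.universal (λ e → trans (i⊥column (here refl) e) (sym (column-at-o e))) es) ∷
           AllPairs.map⁺ (AllPairs.map
             (λ {_} {e} eq → trans (⌊⌋-difference-zero eq) (sym (column-at-o e))) e-tri))
          (All.tabulate λ p∈ → row⊥ (∈-rows p∈))
          where
          row⊥ : ∀ {p} → ∃[ f ] p ≡ rowPivot f → All (p ⊥ᵖ_) (yPivot ∷ map columnPivot es)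
          row⊥ (difference l r _ _ , refl) =
            trans (y≡t l) (sym (y≡t r)) ∷
            All.map⁺ (All.universal (λ e → trans (i⊥column l e) (sym (i⊥column r e))) es)

        total : suc (length fs + length es) ≤ suc d
        total = subst (_≤ suc d) (begin-equality
          length L
            ≡⟨ List.length-++ (reverse (map rowPivot fs)) ⟩
          length (reverse (map rowPivot fs)) + suc (length (map columnPivot es))
            ≡⟨ cong₂ (λ m n → m + suc n)
                 (trans (List.length-reverse (map rowPivot fs)) (List.length-map rowPivot fs))
                 (List.length-map columnPivot es) ⟩
          length fs + suc (length es)
            ≡⟨ ℕ.+-suc (length fs) (length es) ⟩
          suc (length fs + length es) ∎) (rank L within tri)

      Saturated : (X → ℚ) → (X → ℚ) → Set a
      Saturated u w = All (λ i → u i ≡ 0ℚ → w i ≡ 0ℚ) A → Any (λ i → w i ≡ 0ℚ × u i ≢ 0ℚ) A →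
                      All (λ i → w i ≡ 0ℚ) A

      -- A single pass over `W` suffices. Replacing `v` by a `w` with a larger zero set keeps
      -- saturation against the functions already treated, since both premises of `Saturated` become
      -- stronger.
      saturate : ∀ (W : List (∃ Mem)) {u} → Mem u → Any (λ i → u i ≢ 0ℚ) A →
        ∃[ v ] Mem v × All (λ i → u i ≡ 0ℚ → v i ≡ 0ℚ) A × Any (λ i → v i ≢ 0ℚ) A ×
               All (Saturated v ∘ proj₁) W
      saturate []             Mu nz = _ , Mu , All.universal (λ _ z → z) A , nz , []
      saturate ((w , Mw) ∷ W) Mu nz with saturate W Mu nz
      ... | v , Mv , u⊆v , v-nz , sat
        with all? (λ i → (v i ℚ.≟ 0ℚ) →-dec (w i ℚ.≟ 0ℚ)) A
           | any? (λ i → (w i ℚ.≟ 0ℚ) ×-dec ¬? (v i ℚ.≟ 0ℚ)) A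
           | any? (λ i → ¬? (w i ℚ.≟ 0ℚ)) A
      ... | no ¬v⊆w | _ | _ = v , Mv , u⊆v , v-nz , (λ v⊆w _ → contradiction v⊆w ¬v⊆w) ∷ sat
      ... | yes _ | no ¬grow | _ = v , Mv , u⊆v , v-nz , (λ _ grow → contradiction grow ¬grow) ∷ sat
      ... | yes _ | yes _ | no w≡0 = v , Mv , u⊆v , v-nz ,
        (λ _ _ → All.map (λ {i} → decide i) (All.¬Any⇒All¬ A w≡0)) ∷ sat
        where
        decide : ∀ i → ¬ (w i ≢ 0ℚ) → w i ≡ 0ℚ
        decide i ¬¬eq with w i ℚ.≟ 0ℚ
        ... | yes eq = eq
        ... | no neq = contradiction neq ¬¬eq
      ... | yes v⊆w | yes _ | yes w-nz =
        w , Mw , All.zipWith (λ (f , g) → g ∘ f) (u⊆v , v⊆w) , w-nz ,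
        (λ _ bad → let w≡0 , w≢0 = Any.lookup-index bad in contradiction w≡0 w≢0) ∷
        All.map (λ sat-v w⊆x grow → sat-v (All.zipWith (λ (f , g) → g ∘ f) (v⊆w , w⊆x)) (shrink grow)) sat
        where
        shrink : ∀ {x : X → ℚ} → Any (λ i → x i ≡ 0ℚ × w i ≢ 0ℚ) A → Any (λ i → x i ≡ 0ℚ × v i ≢ 0ℚ) A
        shrink grow with find grow
        ... | i , i∈A , xi≡0 , wi≢0 = lose i∈A (xi≡0 , λ vi≡0 → wi≢0 (All.lookup v⊆w i∈A vi≡0))

  ⌊⌋-sum-complement : ∀ {x y} → x ≢ y → ⌊ x ⌋ - (0ℚ - ⌊ y ⌋) ≡ 1ℚ
  ⌊⌋-sum-complement {true}  {true}  x≢y = contradiction refl x≢y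
  ⌊⌋-sum-complement {false} {false} x≢y = contradiction refl x≢y
  ⌊⌋-sum-complement {true}  {false} _   = refl
  ⌊⌋-sum-complement {false} {true}  _   = refl

  -- The cross terms do not exceed the diagonal ones: with `α₀ = α₁ + x` and `ρ = δ + y` the two
  -- sums differ by `x * y`.
  combine-bounds : ∀ {α₀ α₁ ρ δ M N} → α₁ ≤ α₀ → δ ≤ ρ → α₀ * ρ ≤ M → α₁ * δ ≤ N →
                   (α₀ + α₁) * (ρ + δ) ≤ (M + N) + (M + N)
  combine-bounds {α₀} {α₁} {ρ} {δ} {M} {N} α₁≤α₀ δ≤ρ αρ≤M αδ≤N = begin
    (α₀ + α₁) * (ρ + δ)
      ≡⟨ solve 4 (λ a b r s → (a :+ b) :* (r :+ s) := (a :* r :+ b :* s) :+ (a :* s :+ b :* r))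
           refl α₀ α₁ ρ δ ⟩
    (α₀ * ρ + α₁ * δ) + (α₀ * δ + α₁ * ρ)
      ≤⟨ ℕ.+-mono-≤ diagonal (ℕ.≤-trans rearrange diagonal) ⟩
    (M + N) + (M + N) ∎
    where
    open ℕ.≤-Reasoning
    open ℕSolver.+-*-Solver

    diagonal : α₀ * ρ + α₁ * δ ≤ M + N
    diagonal = ℕ.+-mono-≤ αρ≤M αδ≤N

    rearrange : α₀ * δ + α₁ * ρ ≤ α₀ * ρ + α₁ * δ
    rearrange with ℕ.m≤n⇒∃[o]m+o≡n α₁≤α₀ | ℕ.m≤n⇒∃[o]m+o≡n δ≤ρ
    ... | x , refl | y , refl = begin
      (α₁ + x) * δ + α₁ * (δ + y)              ≤⟨ ℕ.m≤m+n _ (x * y) ⟩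
      (α₁ + x) * δ + α₁ * (δ + y) + x * y
        ≡⟨ solve 4 (λ a x s y → (a :+ x) :* s :+ a :* (s :+ y) :+ x :* y := (a :+ x) :* (s :+ y) :+ a :* s)
             refl α₁ x δ y ⟩
      (α₁ + x) * (δ + y) + α₁ * δ              ∎

  -- The induction on the rank.

  module _ {a p} {X : Set a} (S : FunctionSpace X p) where
    open FunctionSpace S
    private
      Col  = Column S
      val  = Column.val {S = S}
      cmem = Column.mem {S = S}

    -- The row `o`, at which all columns vanish, takes the place of the zero vector.
    Bound : ℕ → Set _
    Bound d = ∀ {A B o} → o ∈ˡ A → All (λ c → val c o ≡ false) B → DistinctRows S B A →
              DistinctColumns S A B → RankAtMost S A d → length A * length B ≤ suc d * 2 ^ d

    -- The function whose zero set in `A` is A₀. Saturation against gaps makes columns with equal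
    -- restriction complementary off A₀; saturation against differences of gaps makes all such pairs
    -- agree there up to complement.
    record SaturatedHyperplane {A o} (o∈A : o ∈ˡ A) (B : List Col) (b : Col) : Set (a ⊔ p) where
      field
        v              : X → ℚ
        mem            : Mem v
        vanishes       : ∀ {i} → i ∈ˡ A → val b i ≡ false → v i ≡ 0ℚ
        nonzero        : Any (λ i → v i ≢ 0ℚ) A
        gap-saturated  : ∀ {c c′} → c ∈ˡ B → c′ ∈ˡ B → Saturated S o∈A v (proj₁ (gap S c c′))
        gap₂-saturated : ∀ {c c′ e e′} → c ∈ˡ B → c′ ∈ˡ B → e ∈ˡ B → e′ ∈ˡ B →
                         Saturated S o∈A v (proj₁ (gap₂ S (gap S c c′) (gap S e e′)))

    saturatedHyperplane : ∀ {A o} (o∈A : o ∈ˡ A) B {b} → Any (λ i → val b i ≡ true) A →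
                          SaturatedHyperplane o∈A B b
    saturatedHyperplane {A} o∈A B {b} b-nz
      with saturate S o∈A (gaps ++ cartesianProductWith (gap₂ S) gaps gaps) (cmem b)
             (Any.map (λ {i} eq z → contradiction (trans (sym z) (cong ⌊_⌋ eq)) λ ()) b-nz)
      where
      gaps = cartesianProductWith (gap S) B B
    ... | v , Mv , b⊆v , v-nz , saturated = record
      { v              = v
      ; mem            = Mv
      ; vanishes       = λ i∈ eq → All.lookup b⊆v i∈ (cong ⌊_⌋ eq)
      ; nonzero        = v-nz
      ; gap-saturated  = λ c∈ c′∈ → All.lookup saturated (∈-++⁺ˡ (gap∈ c∈ c′∈))
      ; gap₂-saturated = λ c∈ c′∈ e∈ e′∈ → All.lookup saturated
          (∈-++⁺ʳ _ (∈-cartesianProductWith⁺ (gap₂ S) (gap∈ c∈ c′∈) (gap∈ e∈ e′∈)))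
      }
      where
      gap∈ : ∀ {c c′} → c ∈ˡ B → c′ ∈ˡ B → gap S c c′ ∈ˡ cartesianProductWith (gap S) B B
      gap∈ = ∈-cartesianProductWith⁺ (gap S)

    module _ {d A B o b} (o∈A : o ∈ˡ A) (vanish : All (λ c → val c o ≡ false) B)
             (rows : DistinctRows S B A) (columns : DistinctColumns S A B)
             (rank : RankAtMost S A (suc d)) (b∈B : b ∈ˡ B)
             (hyperplane : SaturatedHyperplane o∈A B b) where

      open SaturatedHyperplane hyperplane using (v; gap-saturated; gap₂-saturated) renaming
        (mem to Mv; vanishes to v-vanishes; nonzero to v-nz)

      private
        on? : Decidable (λ i → val b i ≡ true)
        on? i = val b i Bool.≟ true

        zero? : Decidable (λ i → v i ≡ 0ℚ)
        zero? i = v i ℚ.≟ 0ℚ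

        A₀ A₁ : List X
        A₀ = filter zero? A
        A₁ = filter (¬? ∘ zero?) A

        A₀⁻ : ∀ {i} → i ∈ˡ A₀ → i ∈ˡ A
        A₀⁻ i∈ = proj₁ (∈-filter⁻ zero? i∈)

        A₁⁻ : ∀ {i} → i ∈ˡ A₁ → i ∈ˡ A × v i ≢ 0ℚ
        A₁⁻ i∈ = ∈-filter⁻ (¬? ∘ zero?) {xs = A} i∈

        i₁ : X
        i₁ = proj₁ (find v-nz)

        i₁∈A₁ : i₁ ∈ˡ A₁
        i₁∈A₁ = let _ , i∈A , v≢0 = find v-nz in ∈-filter⁺ (¬? ∘ zero?) i∈A v≢0

        o∈A₀ : o ∈ˡ A₀
        o∈A₀ = ∈-filter⁺ zero? o∈A (v-vanishes o∈A (All.lookup vanish b∈B))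

        -- Wrapped in a record so that the two columns can be inferred from a proof.
        record _~_ (c c′ : Col) : Set a where
          constructor agreeing
          field on-A₀ : All (λ i → val c i ≡ val c′ i) A₀
        open _~_

        ~-sym : ∀ {c c′} → c ~ c′ → c′ ~ c
        ~-sym (agreeing e) = agreeing (All.map sym e)

        ~-trans : ∀ {c c′ c″} → c ~ c′ → c′ ~ c″ → c ~ c″
        ~-trans (agreeing e) (agreeing f) = agreeing (All.zipWith (λ (x , y) → trans x y) (e , f))

        ~-refl : ∀ {c} → c ~ c
        ~-refl = agreeing (All.universal (λ _ → refl) A₀)

        _~?_ : ∀ c c′ → Dec (c ~ c′)
        c ~? c′ = map′ agreeing on-A₀ (all? (λ i → val c i Bool.≟ val c′ i) A₀)

        ≁⇒Differ : ∀ {c c′} → ¬ c ~ c′ → Differ val A₀ c c′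
        ≁⇒Differ {c} {c′} c≁c′ = All.¬All⇒Any¬ (λ i → val c i Bool.≟ val c′ i) A₀ (c≁c′ ∘ agreeing)

        gap-vanishes : ∀ {c c′ i} → c ~ c′ → i ∈ˡ A → v i ≡ 0ℚ → proj₁ (gap S c c′) i ≡ 0ℚ
        gap-vanishes c~c′ i∈ vi≡0 = ⌊⌋-difference-zero (All.lookup (on-A₀ c~c′) (∈-filter⁺ zero? i∈ vi≡0))

        -- If the columns met at a row of `A₁`, their gap would vanish on `A₀` and at one further
        -- row, hence on all of `A` by saturation, against `Differ`.
        complementary : ∀ {c c′} → c ∈ˡ B → c′ ∈ˡ B → Differ val A c c′ → c ~ c′ →
                        ∀ {i} → i ∈ˡ A₁ → val c i ≢ val c′ i
        complementary c∈ c′∈ differ c~c′ i∈ eq = All.All¬⇒¬Any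
          (All.map (λ z x≢y → x≢y (⌊⌋-difference-zero⁻ z))
            (gap-saturated c∈ c′∈
              (All.tabulate (gap-vanishes c~c′))
              (lose (proj₁ (A₁⁻ i∈)) (⌊⌋-difference-zero eq , proj₂ (A₁⁻ i∈)))))
          differ

        pairing : Pairing _~_ (Differ val A) B
        pairing = pairUp ~-refl ~-trans _~?_ B columns
          -- Three columns with the same restriction would have pairwise different bits at `i₁`.
          λ x∈ y∈ z∈ x#y y#z x#z x~y y~z → bool-pigeonhole
            (complementary x∈ y∈ x#y x~y i₁∈A₁)
            (complementary y∈ z∈ y#z y~z i₁∈A₁)
            (complementary x∈ z∈ x#z (~-trans x~y y~z) i₁∈A₁)

        open Pairing pairing

        Twins : Pred (Col × Col) _
        Twins (c , c′) = c ∈ˡ B × c′ ∈ˡ B × Differ val A c c′ × c ~ c′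

        -- Twins are ordered by their values at `i₁`, so that `high - low` is 1 there for every pair
        -- and differences of such gaps vanish at `i₁`.
        record Oriented (cs : Col × Col) : Set (a ⊔ p) where
          field
            {low high} : Col
            low∈       : low ∈ˡ B
            high∈      : high ∈ˡ B
            low~       : low ~ proj₁ cs
            low~high   : low ~ high
            low≢high   : ∀ {i} → i ∈ˡ A₁ → val low i ≢ val high i
            low-i₁     : val low i₁ ≡ false
            high-i₁    : val high i₁ ≡ true

        orient : ∀ {cs} → Twins cs → Oriented cs
        orient {c , c′} (c∈ , c′∈ , differ , c~c′) with val c i₁ in eq
        ... | false = record
          { low∈ = c∈ ; high∈ = c′∈ ; low~ = ~-refl ; low~high = c~c′
          ; low≢high = complementary c∈ c′∈ differ c~c′
          ; low-i₁ = eq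
          ; high-i₁ = Bool.¬-not λ e → complementary c∈ c′∈ differ c~c′ i₁∈A₁ (trans eq (sym e)) }
        ... | true = record
          { low∈ = c′∈ ; high∈ = c∈ ; low~ = ~-sym c~c′ ; low~high = ~-sym c~c′
          ; low≢high = λ i∈ → complementary c∈ c′∈ differ c~c′ i∈ ∘ sym
          ; low-i₁ = Bool.¬-not λ e → complementary c∈ c′∈ differ c~c′ i₁∈A₁ (trans eq (sym e))
          ; high-i₁ = eq }

        -- The difference of the two gaps vanishes on `A₀`, where twins are equal, and at `i₁` by
        -- the orientation, hence on all of `A` by saturation. On `A₁` the gaps are nonzero, so
        -- their equality forces that of the lower columns.
        lows-agree : ∀ {cs ds} (P : Oriented cs) (Q : Oriented ds) → ∀ {i} → i ∈ˡ A₁ →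
                     val (Oriented.low P) i ≡ val (Oriented.low Q) i
        lows-agree P Q i∈ = ⌊⌋-equal-gaps (P.low≢high i∈) (Q.low≢high i∈)
          (All.lookup
            (gap₂-saturated P.high∈ P.low∈ Q.high∈ Q.low∈
              (All.tabulate λ j∈ vj≡0 → cong₂ _-_ (gap-vanishes (~-sym P.low~high) j∈ vj≡0)
                                                 (gap-vanishes (~-sym Q.low~high) j∈ vj≡0))
              (lose (proj₁ (A₁⁻ i₁∈A₁))
                (cong₂ _-_ (cong₂ _-_ (cong ⌊_⌋ P.high-i₁) (cong ⌊_⌋ P.low-i₁))
                           (cong₂ _-_ (cong ⌊_⌋ Q.high-i₁) (cong ⌊_⌋ Q.low-i₁)) ,
                 proj₂ (A₁⁻ i₁∈A₁))))
            (proj₁ (A₁⁻ i∈)))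
          where
          module P = Oriented P
          module Q = Oriented Q

        lows : ∀ {D} → All Twins D → List Col
        lows ts = All.reduce (Oriented.low ∘ orient) ts

        lows⁻ : ∀ {D} (ts : All Twins D) {c} → c ∈ˡ lows ts →
                ∃[ cs ] cs ∈ˡ D × Σ (Oriented cs) λ P → c ≡ Oriented.low P
        lows⁻ (t ∷ _)  (here refl) = _ , here refl , orient t , refl
        lows⁻ (_ ∷ ts) (there c∈)  = let cs , cs∈ , rest = lows⁻ ts c∈ in cs , there cs∈ , rest

        -- On `A₀` a lower column equals the first entry of its pair, and these first entries have
        -- different restrictions.
        lows-distinct : ∀ {D} (ts : All Twins D) → AllPairs (λ (x , _) (y , _) → ¬ x ~ y) D →
                        DistinctColumns S A (lows ts)
        lows-distinct []       []       = []
        lows-distinct (t ∷ ts) (h ∷ hs) = All.tabulate differ ∷ lows-distinct ts hs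
          where
          differ : ∀ {c} → c ∈ˡ lows ts → Differ val A (Oriented.low (orient t)) c
          differ c∈ with lows⁻ ts c∈
          ... | cs , cs∈ , P , refl
            with find (≁⇒Differ λ l~l → All.lookup h cs∈
                   (~-trans (~-sym (Oriented.low~ (orient t))) (~-trans l~l (Oriented.low~ P))))
          ...   | i , i∈ , l≢l = lose (A₀⁻ i∈) l≢l

        length-lows : ∀ {D} (ts : All Twins D) → length (lows ts) ≡ length D
        length-lows []       = refl
        length-lows (_ ∷ ts) = cong suc (length-lows ts)

        pairs-bound : length A₁ * length pairs ≤ 2 ^ d
        pairs-bound = go pairs-⊆ pairs-distinct
          where
          go : ∀ {D} (ts : All Twins D) → AllPairs (λ (x , _) (y , _) → ¬ x ~ y) D →
               length A₁ * length D ≤ 2 ^ d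
          go []          _    = subst (_≤ 2 ^ d) (sym (ℕ.*-zeroʳ (length A₁))) z≤n
          go ts@(t ∷ _) dist = subst (λ n → length A₁ * n ≤ 2 ^ d) (length-lows ts)
            (orthogonal-bound S o∈A rank
              (All.tabulate (proj₁ ∘ A₁⁻)) (AllPairs.filter⁺ (¬? ∘ zero?) rows) (lows-distinct ts dist)
              (All.tabulate low-o)
              agree
              -- The function `y` is the sum of the first pair of twins: it is 1 on `A₁`, where they
              -- are complementary, and 0 at `o`.
              (sub (cmem T.low) (sub (const 0ℚ) (cmem T.high)))
              (λ i∈ → ⌊⌋-sum-complement (T.low≢high i∈))
              λ eq → contradiction (trans (sym (cong₂ (λ x y → ⌊ x ⌋ - (0ℚ - ⌊ y ⌋))
                       (All.lookup vanish T.low∈) (All.lookup vanish T.high∈))) eq) λ ())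
            where
            module T = Oriented (orient t)

            low-o : ∀ {c} → c ∈ˡ lows ts → val c o ≡ false
            low-o c∈ with lows⁻ ts c∈
            ... | _ , _ , P , refl = All.lookup vanish (Oriented.low∈ P)

            agree : ∀ {c c′ i} → c ∈ˡ lows ts → c′ ∈ˡ lows ts → i ∈ˡ A₁ → val c i ≡ val c′ i
            agree c∈ c′∈ i∈ with lows⁻ ts c∈ | lows⁻ ts c′∈
            ... | _ , _ , P , refl | _ , _ , Q , refl = lows-agree P Q i∈

        pairs≤reps : length pairs ≤ length reps
        pairs≤reps = subst (_≤ length reps) (List.length-map proj₁ pairs)
          (length-≤-representatives {_~_ = _~_} ~-sym ~-trans (AllPairs.map⁺ pairs-distinct)
            (All.map⁺ (All.map (λ (x∈ , _) → All.lookup reps-cover x∈) pairs-⊆)))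

        -- Every column has the restriction of some representative, so the representatives still
        -- separate the rows of `A₀`.
        reps-rows : DistinctRows S reps A₀
        reps-rows = AllPairs-map-∈ (covered-differ (flip val) (All.map (Any.map on-A₀) reps-cover))
                                   (AllPairs.filter⁺ zero? rows)

      -- The inductive step when `b` vanishes on at least half of the rows. Since `v` vanishes
      -- wherever `b` does, `A₀` is then at least as large as `A₁`, as `combine-bounds` requires.
      large-zero-side : Bound d → length (filter on? A) ≤ length (filter (¬? ∘ on?) A) →
                        length A * length B ≤ suc (suc d) * 2 ^ suc d
      large-zero-side bound on≤off = begin
        length A * length B
          ≡⟨ cong₂ _*_ (sym (length-filter-¬ zero? A)) length-split ⟩
        (length A₀ + length A₁) * (length reps + length pairs)
          ≤⟨ combine-bounds A₁≤A₀ pairs≤reps reps-bound pairs-bound ⟩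
        (suc d * 2 ^ d + 2 ^ d) + (suc d * 2 ^ d + 2 ^ d)
          ≡⟨ solve 2 (λ n N → (n :* N :+ N) :+ (n :* N :+ N) := (con 1 :+ n) :* (N :+ (N :+ con 0)))
               refl (suc d) (2 ^ d) ⟩
        suc (suc d) * 2 ^ suc d ∎
        where
        open ℕ.≤-Reasoning
        open ℕSolver.+-*-Solver

        reps-bound : length A₀ * length reps ≤ suc d * 2 ^ d
        reps-bound = bound o∈A₀ (All.map (All.lookup vanish) reps-⊆) reps-rows
          (AllPairs.map ≁⇒Differ reps-distinct)
          (rank-zeroes S o∈A Mv (v-vanishes o∈A (All.lookup vanish b∈B)) v-nz rank)

        off≤A₀ : length (filter (¬? ∘ on?) A) ≤ length A₀
        off≤A₀ = length-filter-mono (¬? ∘ on?) zero?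
          (All.tabulate λ i∈ ¬on → v-vanishes i∈ (Bool.¬-not ¬on))

        A₁≤A₀ : length A₁ ≤ length A₀
        A₁≤A₀ = ℕ.+-cancelˡ-≤ (length A₀) (length A₁) (length A₀) (begin
          length A₀ + length A₁                               ≡⟨ length-filter-¬ zero? A ⟩
          length A                                            ≡⟨ length-filter-¬ on? A ⟨
          length (filter on? A) + length (filter (¬? ∘ on?) A) ≤⟨ ℕ.+-mono-≤ (ℕ.≤-trans on≤off off≤A₀) off≤A₀ ⟩
          length A₀ + length A₀                               ∎)

    product-bound : ∀ d → Bound d
    product-bound d {A} {B} {o} o∈A vanish rows columns rank
      with any? (λ c → any? (λ i → val c i Bool.≟ true) A) B
    -- A zero matrix with distinct rows and distinct columns has at most one of each.
    ... | no all-false = begin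
      length A * length B   ≤⟨ ℕ.*-mono-≤ A≤1 B≤1 ⟩
      1                     ≤⟨ ℕ.m^n>0 2 d ⟩
      2 ^ d                 ≤⟨ ℕ.m≤n*m (2 ^ d) (suc d) ⟩
      suc d * 2 ^ d         ∎
      where
      open ℕ.≤-Reasoning

      false-at : ∀ {c i} → c ∈ˡ B → i ∈ˡ A → val c i ≡ false
      false-at c∈ i∈ = Bool.¬-not λ eq → all-false (lose c∈ (lose i∈ eq))

      A≤1 : length A ≤ 1
      A≤1 = length-trivial rows λ x∈ y∈ differ → let _ , c∈ , x≢y = find differ in
        x≢y (trans (false-at c∈ x∈) (sym (false-at c∈ y∈)))

      B≤1 : length B ≤ 1
      B≤1 = length-trivial columns λ x∈ y∈ differ → let _ , i∈ , x≢y = find differ in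
        x≢y (trans (false-at x∈ i∈) (sym (false-at y∈ i∈)))
    product-bound zero {A} {B} {o} o∈A vanish rows columns rank | yes some
      with find some
    ... | b , b∈ , nz with find nz
    -- A nonzero column already gives a triangular system of length one, which rank 0 excludes.
    ...   | i , i∈ , bi≡true = contradiction (rank (pivot ∷ []) ((i∈ , o∈A) ∷ []) ([] ∷ [])) λ ()
      where
      pivot : Pivot S
      pivot = record
        { left = i ; right = o ; fun = ⌊_⌋ ∘ val b ; mem = cmem b
        ; nonzero = λ eq → contradiction
            (trans (sym bi≡true) (trans (⌊⌋-injective eq) (All.lookup vanish b∈))) λ () }
    product-bound (suc d) {A} {B} {o} o∈A vanish rows columns rank | yes some
      with find some
    ... | b , b∈ , nz
      with ℕ.≤-total (length (filter (λ i → val b i Bool.≟ true) A))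
                     (length (filter (¬? ∘ (λ i → val b i Bool.≟ true)) A))
    ...   | inj₁ on≤off = large-zero-side o∈A vanish rows columns rank b∈ (saturatedHyperplane o∈A B nz)
        (product-bound d) on≤off
    ...   | inj₂ off≤on with find nz
    ...     | i , i∈ , bi≡true = subst (λ n → length A * n ≤ _) (List.length-map (flipAt S i) B)
      -- After translation by the row `i` the zero row is `i`, and `b` becomes its complement, which
      -- is true at `o` and vanishes on at least half of the rows.
      (large-zero-side i∈
        (All.map⁺ (All.universal (λ c → Bool.xor-same (val c i)) B))
        (AllPairs.map (λ differ → Any.map⁺ (Any.map (λ {c} x≢y → x≢y ∘ xor-cancelʳ (val c i)) differ)) rows)
        (AllPairs.map⁺ (AllPairs-map-∈ flip-differ columns))
        rank (∈-map⁺ (flipAt S i) b∈)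
        (saturatedHyperplane i∈ _ (lose o∈A (cong₂ _xor_ (All.lookup vanish b∈) bi≡true)))
        (product-bound d)
        (ℕ.≤-trans (length-filter-mono _ _ (All.universal on⇒off A))
          (ℕ.≤-trans off≤on (length-filter-mono _ _ (All.universal on⇒off′ A)))))
      where
      flip-differ : ∀ {c c′} → c ∈ˡ B → c′ ∈ˡ B → Differ val A c c′ →
                    Differ val A (flipAt S i c) (flipAt S i c′)
      flip-differ {c} {c′} c∈ c′∈ differ with val c i Bool.≟ val c′ i
      ... | yes eq = Any.map (λ {j} x≢y e → x≢y (xor-cancelʳ (val c i)
                       (trans e (cong (val c′ j xor_) (sym eq))))) differ
      -- At `o` the original columns vanish, so each flipped column takes there the value of the
      -- original one at `i`.
      ... | no neq = lose o∈A λ e → neq (trans (sym (cong (_xor val c i) (All.lookup vanish c∈)))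
                       (trans e (cong (_xor val c′ i) (All.lookup vanish c′∈))))

      on⇒off : ∀ j → val b j xor val b i ≡ true → val b j ≢ true
      on⇒off j e bj≡true = contradiction (trans (sym e) (cong₂ _xor_ bj≡true bi≡true)) λ ()

      on⇒off′ : ∀ j → val b j ≡ true → val b j xor val b i ≢ true
      on⇒off′ j bj≡true e = contradiction (trans (sym e) (cong₂ _xor_ bj≡true bi≡true)) λ ()

-- Linear algebra over a commutative ring with apartness.

open Combinatorics

-- A constructive integral domain, with `Apart` as a positive form of being nonzero. `Apart-+⁻`
-- locates a pivot in a sum, and `Apart-*` keeps the diagonal nonzero under elimination.
record ApartDomain : Set₁ where
  field
    commutativeRing : CommutativeRing 0ℓ 0ℓ
  open CommutativeRing commutativeRing public
  field
    Apart       : Carrier → Set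
    Apart-resp  : ∀ {x y} → x ≈ y → Apart x → Apart y
    Apart-*     : ∀ {x y} → Apart x → Apart y → Apart (x * y)
    Apart-*⁻ˡ   : ∀ {x y} → Apart (x * y) → Apart x
    Apart-+⁻    : ∀ {x y} → Apart (x + y) → Apart x ⊎ Apart y
    ¬Apart-0    : ¬ Apart 0#
    ι           : ℚ → Carrier
    ι-0         : ι 0ℚ ≈ 0#
    ι-1         : ι 1ℚ ≈ 1#
    ι-+         : ∀ p q → ι (p ℚ.+ q) ≈ ι p + ι q
    Apart-ι     : ∀ {q} → q ≢ 0ℚ → Apart (ι q)

module LinearAlgebra (D : ApartDomain) where
  open ApartDomain D
  open SemiringSum semiring
  open RingProperties (CommutativeRing.ring commutativeRing) using (-‿distribˡ-*; -1*x≈-x)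
  open GroupProperties +-group using () renaming (inverseˡ-unique to +-inverseˡ-unique; x≈z//y to x≈z-y)
  open SetoidReasoning setoid
  open ℚSolver.+-*-Solver using (solve; _:=_; _:+_; _:-_)

  ⟨_,_⟩ : ∀ {d} → Vector Carrier d → Vector Carrier d → Carrier
  ⟨ x , v ⟩ = sum (zipWith _*_ x v)

  ⟨,⟩-comm : ∀ {d} (x v : Vector Carrier d) → ⟨ x , v ⟩ ≈ ⟨ v , x ⟩
  ⟨,⟩-comm x v = sum-cong-≋ λ i → *-comm (x i) (v i)

  ⟨,⟩-linearˡ : ∀ {d} c (x : Vector Carrier d) e y v →
                ⟨ (λ i → c * x i + e * y i) , v ⟩ ≈ c * ⟨ x , v ⟩ + e * ⟨ y , v ⟩
  ⟨,⟩-linearˡ c x e y v = begin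
    sum (λ i → (c * x i + e * y i) * v i)
      ≈⟨ sum-cong-≋ (λ i → trans (distribʳ (v i) (c * x i) (e * y i))
           (+-cong (*-assoc c (x i) (v i)) (*-assoc e (y i) (v i)))) ⟩
    sum (λ i → c * (x i * v i) + e * (y i * v i))
      ≈⟨ ∑-distrib-+ (λ i → c * (x i * v i)) (λ i → e * (y i * v i)) ⟩
    sum (λ i → c * (x i * v i)) + sum (λ i → e * (y i * v i))
      ≈⟨ +-cong (*-distribˡ-sum c (λ i → x i * v i)) (*-distribˡ-sum e (λ i → y i * v i)) ⟨
    c * ⟨ x , v ⟩ + e * ⟨ y , v ⟩ ∎

  infixl 6 _⊖_
  -- Written as a linear combination so that `⟨,⟩-linearˡ` applies directly.
  _⊖_ : ∀ {d} → Vector Carrier d → Vector Carrier d → Vector Carrier d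
  (x ⊖ y) i = 1# * x i + (- 1#) * y i

  ⟨,⟩-⊖ˡ : ∀ {d} (x y v : Vector Carrier d) → ⟨ x ⊖ y , v ⟩ ≈ ⟨ x , v ⟩ - ⟨ y , v ⟩
  ⟨,⟩-⊖ˡ x y v = trans (⟨,⟩-linearˡ 1# x (- 1#) y v) (+-cong (*-identityˡ ⟨ x , v ⟩) (-1*x≈-x ⟨ y , v ⟩))

  ⟨,⟩-⊖ʳ : ∀ {d} (v x y : Vector Carrier d) → ⟨ v , x ⊖ y ⟩ ≈ ⟨ v , x ⟩ - ⟨ v , y ⟩
  ⟨,⟩-⊖ʳ v x y = begin
    ⟨ v , x ⊖ y ⟩          ≈⟨ ⟨,⟩-comm v (x ⊖ y) ⟩
    ⟨ x ⊖ y , v ⟩          ≈⟨ ⟨,⟩-⊖ˡ x y v ⟩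
    ⟨ x , v ⟩ - ⟨ y , v ⟩  ≈⟨ +-cong (⟨,⟩-comm x v) (-‿cong (⟨,⟩-comm y v)) ⟩
    ⟨ v , x ⟩ - ⟨ v , y ⟩  ∎

  sum-zero : ∀ {d} (v : Vector Carrier d) → (∀ i → v i ≈ 0#) → sum v ≈ 0#
  sum-zero {d} v v≈0 = trans (sum-cong-≋ v≈0) (sum-replicate-zero d)

  Apart-sum⁻ : ∀ {d} (v : Vector Carrier d) → Apart (sum v) → ∃[ i ] Apart (v i)
  Apart-sum⁻ {zero}  v ap = contradiction ap ¬Apart-0
  Apart-sum⁻ {suc d} v ap with Apart-+⁻ ap
  ... | inj₁ ap₀ = Fin.zero , ap₀
  ... | inj₂ ap₊ = let i , api = Apart-sum⁻ (v ∘ Fin.suc) ap₊ in Fin.suc i , api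

  -- Gaussian elimination without division, as no inverses are available.
  eliminate : ∀ {d} → Vector Carrier (suc d) → Fin (suc d) → Vector Carrier (suc d) → Vector Carrier d
  eliminate f p x i = f p * x (punchIn p i) + (- x p) * f (punchIn p i)

  -- Since `⟨ f , v ⟩` vanishes, `⟨ f′ , v′ ⟩` is `- (f p * v p)`. The second term of `eliminate`
  -- therefore contributes `f p * (x p * v p)`, the product lost by removing coordinate `p`.
  ⟨eliminate,removeAt⟩ : ∀ {d} f p (x v : Vector Carrier (suc d)) → ⟨ f , v ⟩ ≈ 0# →
                         ⟨ eliminate f p x , removeAt v p ⟩ ≈ f p * ⟨ x , v ⟩
  ⟨eliminate,removeAt⟩ f p x v fv≈0 = begin
    ⟨ eliminate f p x , v′ ⟩
      ≈⟨ ⟨,⟩-linearˡ (f p) x′ (- x p) f′ v′ ⟩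
    f p * ⟨ x′ , v′ ⟩ + (- x p) * ⟨ f′ , v′ ⟩
      ≈⟨ +-cong refl (sym cancel) ⟩
    f p * ⟨ x′ , v′ ⟩ + f p * (x p * v p)
      ≈⟨ distribˡ (f p) ⟨ x′ , v′ ⟩ (x p * v p) ⟨
    f p * (⟨ x′ , v′ ⟩ + x p * v p)
      ≈⟨ *-cong refl (trans (+-comm ⟨ x′ , v′ ⟩ (x p * v p)) (sym (sum-remove (zipWith _*_ x v)))) ⟩
    f p * ⟨ x , v ⟩ ∎
    where
    f′ = removeAt f p
    x′ = removeAt x p
    v′ = removeAt v p

    cancel : f p * (x p * v p) ≈ (- x p) * ⟨ f′ , v′ ⟩
    cancel = trans (+-inverseˡ-unique _ _ (begin
      f p * (x p * v p) + x p * ⟨ f′ , v′ ⟩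
        ≈⟨ +-cong (trans (sym (*-assoc (f p) (x p) (v p))) (trans (*-cong (*-comm (f p) (x p)) refl)
             (*-assoc (x p) (f p) (v p)))) refl ⟩
      x p * (f p * v p) + x p * ⟨ f′ , v′ ⟩
        ≈⟨ distribˡ (x p) (f p * v p) ⟨ f′ , v′ ⟩ ⟨
      x p * (f p * v p + ⟨ f′ , v′ ⟩)
        ≈⟨ *-cong refl (trans (sym (sum-remove (zipWith _*_ f v))) fv≈0) ⟩
      x p * 0#
        ≈⟨ zeroʳ (x p) ⟩
      0# ∎)) (-‿distribˡ-* (x p) ⟨ f′ , v′ ⟩)

  -- Induction on the dimension. The first diagonal entry has a summand apart from zero, at `p` say.
  -- Eliminating `p` multiplies the remaining entries on and above the diagonal by `f p`, because
  -- `f` annihilates all later vectors; so the reduced system is again triangular.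
  triangular-length : ∀ {d} (L : List (Vector Carrier d × Vector Carrier d)) →
    All (λ (f , v) → Apart ⟨ f , v ⟩) L → AllPairs (λ (f , _) (_ , v) → ⟨ f , v ⟩ ≈ 0#) L → length L ℕ.≤ d
  triangular-length         []            _          _           = z≤n
  triangular-length {zero}  (_ ∷ _)       (ap ∷ _)   _           = contradiction ap ¬Apart-0
  triangular-length {suc d} ((f , v) ∷ L) (ap ∷ aps) (f⊥L ∷ tri) with Apart-sum⁻ (zipWith _*_ f v) ap
  ... | p , ap-fpvp = s≤s (≡.subst (ℕ._≤ d) (List.length-map reduce L) (triangular-length (map reduce L)
    (All.map⁺ (All.zipWith
      (λ { {g , w} (ap-gw , fw≈0) →
        Apart-resp (sym (⟨eliminate,removeAt⟩ f p g w fw≈0)) (Apart-* ap-fp ap-gw) })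
      (aps , f⊥L)))
    (AllPairs.map⁺ (reduce-tri L f⊥L tri))))
    where
    ap-fp : Apart (f p)
    ap-fp = Apart-*⁻ˡ ap-fpvp

    reduce : Vector Carrier (suc d) × Vector Carrier (suc d) → Vector Carrier d × Vector Carrier d
    reduce (g , w) = eliminate f p g , removeAt w p

    reduce-tri : ∀ L → All (λ (_ , w) → ⟨ f , w ⟩ ≈ 0#) L →
                 AllPairs (λ (g , _) (_ , w) → ⟨ g , w ⟩ ≈ 0#) L →
                 AllPairs (λ a b → ⟨ proj₁ (reduce a) , proj₂ (reduce b) ⟩ ≈ 0#) L
    reduce-tri []            []           []         = []
    reduce-tri ((g , _) ∷ L) (_ ∷ f⊥L) (h ∷ hs) =
      All.zipWith (λ { {_ , w} (fw≈0 , gw≈0) →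
        trans (⟨eliminate,removeAt⟩ f p g w fw≈0) (trans (*-cong refl gw≈0) (zeroʳ (f p))) }) (f⊥L , h) ∷
      reduce-tri L f⊥L hs

  ι-sub : ∀ p q → ι (p ℚ.- q) ≈ ι p - ι q
  ι-sub p q = x≈z-y (ι (p ℚ.- q)) (ι q) (ι p) (trans (sym (ι-+ (p ℚ.- q) q)) (reflexive (cong ι
    (solve 2 (λ p q → p :- q :+ q := p) ≡.refl p q))))

  ι-sub-cong : ∀ {x y} p q r → x ≈ ι p → y ≈ ι q → p ℚ.- q ≡ r → x - y ≈ ι r
  ι-sub-cong p q r x≈ y≈ ≡.refl = trans (+-cong x≈ (-‿cong y≈)) (sym (ι-sub p q))

  -- The rank of rows that are given by vectors.

  module _ {a d} {X : Set a} (vec : X → Vector Carrier d) where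

    -- The rational-valued affine functions of the row vector, with linear part `v` and rational
    -- constant term `t`.
    rowFunctions : FunctionSpace X a
    rowFunctions = record
      { Mem   = λ e → ∃[ v ] ∃[ t ] ∀ x → ⟨ vec x , v ⟩ ≈ ι (e x ℚ.- t)
      ; resp  = λ e≗f (v , t , h) → v , t , λ x → subst (λ q → ⟨ vec x , v ⟩ ≈ ι (q ℚ.- t)) (e≗f x) (h x)
      ; const = λ q → (λ _ → 0#) , q , λ x → trans
          (sum-zero (λ i → vec x i * 0#) (λ i → zeroʳ (vec x i)))
          (sym (trans (reflexive (cong ι (ℚ.+-inverseʳ q))) ι-0))
      ; sub   = λ {e} {f} (v , t , h) (w , s , k) → v ⊖ w , t ℚ.- s , λ x →
          trans (⟨,⟩-⊖ʳ (vec x) v w) (ι-sub-cong (e x ℚ.- t) (f x ℚ.- s) _ (h x) (k x)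
            (solve 4 (λ e t f s → (e :- t) :- (f :- s) := (e :- f) :- (t :- s)) ≡.refl (e x) t (f x) s))
      }

    -- Constant terms cancel on differences of rows, so a triangular system of pivots becomes one of
    -- vectors paired with linear parts.
    rank≤dimension : ∀ A → RankAtMost rowFunctions A d
    rank≤dimension _ L _ tri = subst (ℕ._≤ d) (List.length-map entry L) (triangular-length (map entry L)
      (All.map⁺ (All.universal (λ p → Apart-resp (sym (entry-value p p)) (Apart-ι (nonzero p))) L))
      (AllPairs.map⁺ (AllPairs.map (λ {p} {q} eq → trans (entry-value p q)
        (trans (reflexive (cong ι (≡.trans (cong (ℚ._- Pivot.fun q (Pivot.right p)) eq)
          (ℚ.+-inverseʳ (Pivot.fun q (Pivot.right p)))))) ι-0)) tri)))
      where
      entry : Pivot rowFunctions → Vector Carrier d × Vector Carrier d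
      entry p = vec (Pivot.left p) ⊖ vec (Pivot.right p) , proj₁ (Pivot.mem p)

      entry-value : ∀ p q → ⟨ proj₁ (entry p) , proj₂ (entry q) ⟩ ≈
                            ι (Pivot.fun q (Pivot.left p) ℚ.- Pivot.fun q (Pivot.right p))
      entry-value p q = trans (⟨,⟩-⊖ˡ (vec left) (vec right) v)
        (ι-sub-cong (fun left ℚ.- t) (fun right ℚ.- t) _ (h left) (h right)
          (solve 3 (λ e f t → (e :- t) :- (f :- t) := e :- f) ≡.refl (fun left) (fun right) t))
        where
        open Pivot p using (left; right)
        open Pivot q using (fun; mem)
        v = proj₁ mem
        t = proj₁ (proj₂ mem)
        h = proj₂ (proj₂ mem)

      nonzero : ∀ p → Pivot.fun p (Pivot.left p) ℚ.- Pivot.fun p (Pivot.right p) ≢ 0ℚ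
      nonzero p eq = Pivot.nonzero p (≡.trans (telescope _ _)
        (≡.trans (cong (ℚ._+ Pivot.fun p (Pivot.right p)) eq) (ℚ.+-identityˡ _)))
        where
        telescope : ∀ x y → x ≡ (x ℚ.- y) ℚ.+ y
        telescope = solve 2 (λ x y → x := x :- y :+ y) ≡.refl

  -- Spanning sets separate vectors.

  unit : ∀ {d} → Fin d → Vector Carrier d
  unit Fin.zero    = 1# Vec.∷ λ _ → 0#
  unit (Fin.suc k) = 0# Vec.∷ unit k

  ⟨,unit⟩ : ∀ {d} (x : Vector Carrier d) k → ⟨ x , unit k ⟩ ≈ x k
  ⟨,unit⟩ x Fin.zero = trans
    (+-cong (*-identityʳ (x Fin.zero)) (sum-zero (λ i → x (Fin.suc i) * 0#) λ i → zeroʳ (x (Fin.suc i))))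
    (+-identityʳ (x Fin.zero))
  ⟨,unit⟩ x (Fin.suc k) = trans
    (+-cong (zeroʳ (x Fin.zero)) (⟨,unit⟩ (x ∘ Fin.suc) k))
    (+-identityˡ (x (Fin.suc k)))

  ⟨,combination⟩ : ∀ {d k} (x : Vector Carrier d) (c : Vector Carrier k) (v : Vector (Vector Carrier d) k) →
                   ⟨ x , (λ i → sum (λ j → c j * v j i)) ⟩ ≈ sum (λ j → c j * ⟨ x , v j ⟩)
  ⟨,combination⟩ x c v = begin
    sum (λ i → x i * sum (λ j → c j * v j i))
      ≈⟨ sum-cong-≋ (λ i → *-distribˡ-sum (x i) (λ j → c j * v j i)) ⟩
    sum (λ i → sum (λ j → x i * (c j * v j i)))
      ≈⟨ ∑-comm (λ i j → x i * (c j * v j i)) ⟩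
    sum (λ j → sum (λ i → x i * (c j * v j i)))
      ≈⟨ sum-cong-≋ (λ j → trans (sum-cong-≋ (λ i → swap (x i) (c j) (v j i)))
           (sym (*-distribˡ-sum (c j) (λ i → x i * v j i)))) ⟩
    sum (λ j → c j * ⟨ x , v j ⟩) ∎
    where
    swap : ∀ p q r → p * (q * r) ≈ q * (p * r)
    swap p q r = trans (sym (*-assoc p q r)) (trans (*-cong (*-comm p q) refl) (*-assoc q p r))

  -- A coordinate is the product with a unit vector, which expands into products with the spanning
  -- vectors.
  coordinate-determined : ∀ {d k} (x y : Vector Carrier d) i
    (c : Vector Carrier k) (v : Vector (Vector Carrier d) k) →
    (∀ l → unit i l ≈ sum (λ j → c j * v j l)) → (∀ j → ⟨ x , v j ⟩ ≈ ⟨ y , v j ⟩) → x i ≈ y i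
  coordinate-determined x y i c v unit≈ agree = begin
    x i                            ≈⟨ expand x ⟩
    sum (λ j → c j * ⟨ x , v j ⟩)  ≈⟨ sum-cong-≋ (λ j → *-cong refl (agree j)) ⟩
    sum (λ j → c j * ⟨ y , v j ⟩)  ≈⟨ expand y ⟨
    y i                            ∎
    where
    expand : ∀ z → z i ≈ sum (λ j → c j * ⟨ z , v j ⟩)
    expand z = begin
      z i                                          ≈⟨ ⟨,unit⟩ z i ⟨
      ⟨ z , unit i ⟩                               ≈⟨ sum-cong-≋ (λ l → *-cong refl (unit≈ l)) ⟩
      ⟨ z , (λ l → sum (λ j → c j * v j l)) ⟩      ≈⟨ ⟨,combination⟩ z c v ⟩
      sum (λ j → c j * ⟨ z , v j ⟩)                ∎

  SpansUnits : ∀ {d ℓ} → Pred (Vector Carrier d) ℓ → Set ℓ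
  SpansUnits {d} A = ∀ (i : Fin d) → ∃[ k ] Σ[ c ∈ Vector Carrier k ] Σ[ v ∈ Vector (Vector Carrier d) k ]
    (∀ j → v j ∈ A) × (∀ l → unit i l ≈ sum (λ j → c j * v j l))

  -- The finitely many members of `A` that occur in the expansions of the unit vectors suffice.
  separatingList : ∀ {d ℓ} {A : Pred (Vector Carrier d) ℓ} → SpansUnits A →
    Σ[ L ∈ List (∃ A) ] (∀ x y → All (λ (a , _) → ⟨ x , a ⟩ ≈ ⟨ y , a ⟩) L → ∀ i → x i ≈ y i)
  separatingList {d} {A = A} spans = concat (tabulate block) , λ x y agree i →
    let k , c , v , v∈A , unit≈ = spans i in
    coordinate-determined x y i c v unit≈ (All.tabulate⁻ (All.tabulate⁻ (All.concat⁻ agree) i))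
    where
    block : Fin d → List (∃ A)
    block i = let k , c , v , v∈A , unit≈ = spans i in tabulate λ j → v j , v∈A j

  bit : ∀ {x} → (x ≈ 0#) ⊎ (x ≈ 1#) → Bool
  bit (inj₁ _) = false
  bit (inj₂ _) = true

  bit-correct : ∀ {x} (h : (x ≈ 0#) ⊎ (x ≈ 1#)) → x ≈ ι ⌊ bit h ⌋
  bit-correct (inj₁ x≈0) = trans x≈0 (sym ι-0)
  bit-correct (inj₂ x≈1) = trans x≈1 (sym ι-1)

  -- From sets of vectors to finite matrices of bits.

  module _ {d ℓ₁ ℓ₂} {A : Pred (Vector Carrier d) ℓ₁} {B : Pred (Vector Carrier d) ℓ₂}
           (A-spans : SpansUnits A) (B-spans : SpansUnits B)
           (binary : ∀ a b → a ∈ A → b ∈ B → (⟨ a , b ⟩ ≈ 0#) ⊎ (⟨ a , b ⟩ ≈ 1#)) where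

    -- The row nothing stands for the zero vector.
    Row : Set ℓ₁
    Row = Maybe (∃ A)

    vector : Row → Vector Carrier d
    vector nothing        = λ _ → 0#
    vector (just (a , _)) = a

    entry : ∃ B → Row → Bool
    entry _          nothing          = false
    entry (b , b∈B) (just (a , a∈A)) = bit (binary a b a∈A b∈B)

    entry-correct : ∀ b x → ⟨ vector x , proj₁ b ⟩ ≈ ι ⌊ entry b x ⌋
    entry-correct (b , _)   nothing          = trans (sum-zero (λ i → 0# * b i) λ i → zeroˡ (b i)) (sym ι-0)
    entry-correct (b , b∈B) (just (a , a∈A)) = bit-correct (binary a b a∈A b∈B)

    entry-determines : ∀ b x c y → entry b x ≡ entry c y → ⟨ vector x , proj₁ b ⟩ ≈ ⟨ vector y , proj₁ c ⟩
    entry-determines b x c y eq = trans (entry-correct b x)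
      (trans (reflexive (cong (ι ∘ ⌊_⌋) eq)) (sym (entry-correct c y)))

    column : ∃ B → Column (rowFunctions vector)
    column b = record
      { val = entry b
      ; mem = proj₁ b , 0ℚ , λ x → trans (entry-correct b x)
                (reflexive (cong ι (≡.sym (ℚ.+-identityʳ ⌊ entry b x ⌋)))) }

    -- The row `nothing` may have been discarded as a duplicate; any row of `xs` that agrees with it
    -- on `bs` serves as the zero row.
    distinct-bound : ∀ {bs xs} → AllPairs (Differ entry xs) bs → AllPairs (Differ (flip entry) bs) xs →
                     Any (Agree (flip entry) bs nothing) xs → length xs ℕ.* length bs ℕ.≤ suc d ℕ.* 2 ℕ.^ d
    distinct-bound {bs} {xs} columns rows zero-row with find zero-row
    ... | o , o∈xs , zero~o = subst (λ n → length xs ℕ.* n ℕ.≤ suc d ℕ.* 2 ℕ.^ d) (List.length-map column bs)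
      (product-bound (rowFunctions vector) d o∈xs
        (All.map⁺ (All.map ≡.sym zero~o))
        (AllPairs.map (λ differ → Any.map⁺ differ) rows)
        (AllPairs.map⁺ columns)
        (rank≤dimension vector xs))

    module _ {m n} (f : Fin m → ∃ A) (g : Fin n → ∃ B)
             (f-injective : ∀ {i j} → (∀ k → proj₁ (f i) k ≈ proj₁ (f j) k) → i ≡ j)
             (g-injective : ∀ {i j} → (∀ k → proj₁ (g i) k ≈ proj₁ (g j) k) → i ≡ j) where

      private
        columns : List (∃ B)
        columns = tabulate g

        rows : List Row
        rows = tabulate (just ∘ f)

        columns-differ : ∀ As → (∀ x y → All (λ (a , _) → ⟨ x , a ⟩ ≈ ⟨ y , a ⟩) As → ∀ i → x i ≈ y i) →
                         ∀ {i j} → i ≢ j → Differ entry ((nothing ∷ map just As) ++ rows) (g i) (g j)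
        columns-differ As separate {i} {j} i≢j = ¬Agree⇒Differ entry λ agree → i≢j (g-injective
          (separate (proj₁ (g i)) (proj₁ (g j)) (All.map
            (λ {a} eq → trans (⟨,⟩-comm (proj₁ (g i)) (proj₁ a)) (trans
              (entry-determines (g i) (just a) (g j) (just a) eq) (⟨,⟩-comm (proj₁ a) (proj₁ (g j)))))
            (All.map⁻ (All.++⁻ˡ (map just As) (All.tail agree))))))

        rows-differ : ∀ Bs → (∀ x y → All (λ (b , _) → ⟨ x , b ⟩ ≈ ⟨ y , b ⟩) Bs → ∀ i → x i ≈ y i) →
                      ∀ {i j} → i ≢ j → Differ (flip entry) (Bs ++ columns) (just (f i)) (just (f j))
        rows-differ Bs separate {i} {j} i≢j = ¬Agree⇒Differ (flip entry) λ agree → i≢j (f-injective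
          (separate (proj₁ (f i)) (proj₁ (f j)) (All.map
            (λ {b} eq → entry-determines b (just (f i)) b (just (f j)) eq)
            (All.++⁻ˡ Bs agree))))

      -- The separating lists and the zero row are adjoined to the given families. This makes
      -- distinct vectors differ as strings of bits and cannot decrease the number of rows or
      -- columns.
      finite-bound : m ℕ.* n ℕ.≤ suc d ℕ.* 2 ℕ.^ d
      finite-bound = conclude (adjoin entry columns Bs rows (nothing ∷ map just As)
        (AllPairs.tabulate⁺ (columns-differ As (proj₂ (separatingList A-spans))))
        (AllPairs.tabulate⁺ (rows-differ Bs (proj₂ (separatingList B-spans)))))
        where
        As = proj₁ (separatingList A-spans)
        Bs = proj₁ (separatingList B-spans)

        conclude : Adjoined entry columns rows (nothing ∷ map just As) → m ℕ.* n ℕ.≤ suc d ℕ.* 2 ℕ.^ d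
        conclude adj = ℕ.≤-trans
          (ℕ.*-mono-≤ (subst (ℕ._≤ length vs⁺) (List.length-tabulate (just ∘ f)) vs≤vs⁺)
                      (subst (ℕ._≤ length us⁺) (List.length-tabulate g) us≤us⁺))
          (distinct-bound us-distinct vs-distinct (All.head vs-covered))
          where open Adjoined adj

-- The Cauchy reals as a commutative ring with apartness.

module RealNumbers where

  open Defs
  open import Data.Rational.Base using (_-_; _<_; _≤_) renaming (∣_∣ to abs)
  open ℚSolver.+-*-Solver using (solve; _:=_; _:+_; _:-_; _:*_; :-_)
  open ≡ using (refl; sym; trans)

  -- Unlike _≈_, a record type is injective, so that the two sides of an equation
  -- can be inferred.
  infix 4 _≃_
  record _≃_ (x y : ℝ) : Set where
    constructor equal
    field close : x ≈ y
  open _≃_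

  -- Reduces the ring laws to those of the rationals, term by term.
  ≗⇒≃ : ∀ {x y} → seq x ≗ seq y → x ≃ y
  ≗⇒≃ {x} {y} x≗y .close ε 0<ε = 0 , λ n _ →
    subst (_< ε) (sym (trans (cong (λ q → abs (q - seq y n)) (x≗y n)) (cong abs (ℚ.+-inverseʳ (seq y n))))) 0<ε

  ≃-refl : ∀ {x} → x ≃ x
  ≃-refl = ≗⇒≃ λ _ → refl

  abs-swap : ∀ p q → abs (p - q) ≡ abs (q - p)
  abs-swap p q = trans (sym (ℚ.∣-p∣≡∣p∣ (p - q)))
    (cong abs (solve 2 (λ p q → :- (p :- q) := q :- p) refl p q))

  ≃-sym : ∀ {x y} → x ≃ y → y ≃ x
  ≃-sym {x} {y} (equal x≈y) .close ε 0<ε = let N , h = x≈y ε 0<ε in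
    N , λ n N≤n → subst (_< ε) (abs-swap (seq x n) (seq y n)) (h n N≤n)

  abs-sum-< : ∀ {ε} p q r → r ≡ p ℚ.+ q → abs p < ½ ℚ.* ε → abs q < ½ ℚ.* ε → abs r < ε
  abs-sum-< {ε} p q r eq p< q< = begin-strict
    abs r                    ≡⟨ cong abs eq ⟩
    abs (p ℚ.+ q)            ≤⟨ ℚ.∣p+q∣≤∣p∣+∣q∣ p q ⟩
    abs p ℚ.+ abs q          <⟨ ℚ.+-mono-< p< q< ⟩
    ½ ℚ.* ε ℚ.+ ½ ℚ.* ε      ≡⟨ half+half ε ⟩
    ε                        ∎
    where open ℚ.≤-Reasoning

  ≃-trans : ∀ {x y z} → x ≃ y → y ≃ z → x ≃ z
  ≃-trans {x} {y} {z} (equal x≈y) (equal y≈z) .close ε 0<ε with x≈y _ (half>0 0<ε) | y≈z _ (half>0 0<ε)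
  ... | M , hx | N , hy = M ℕ.⊔ N , λ n p →
    abs-sum-< (seq x n - seq y n) (seq y n - seq z n) (seq x n - seq z n)
      (solve 3 (λ x y z → x :- z := (x :- y) :+ (y :- z)) refl (seq x n) (seq y n) (seq z n))
      (hx n (ℕ.m⊔n≤o⇒m≤o M N p)) (hy n (ℕ.m⊔n≤o⇒n≤o M N p))

  +-cong : ∀ {x x′ y y′} → x ≃ x′ → y ≃ y′ → x + y ≃ x′ + y′
  +-cong {x} {x′} {y} {y′} (equal x≈x′) (equal y≈y′) .close ε 0<ε
    with x≈x′ _ (half>0 0<ε) | y≈y′ _ (half>0 0<ε)
  ... | M , hx | N , hy = M ℕ.⊔ N , λ n p →
    abs-sum-< (seq x n - seq x′ n) (seq y n - seq y′ n) _
      (+-rearrange (seq x n) (seq y n) (seq x′ n) (seq y′ n))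
      (hx n (ℕ.m⊔n≤o⇒m≤o M N p)) (hy n (ℕ.m⊔n≤o⇒n≤o M N p))

  -- As `x` is eventually bounded by some `K`, precision `ε / K` in the other factor suffices.
  *-congˡ : ∀ x {y y′} → y ≃ y′ → x * y ≃ x * y′
  *-congˡ x {y} {y′} (equal y≈y′) .close ε 0<ε = go (bounded (cauchy x))
    where
    open ℚ.≤-Reasoning

    go : EventuallyBounded (seq x) →
         ∃[ N ] ∀ n → N ℕ.≤ n → abs (seq x n ℚ.* seq y n - seq x n ℚ.* seq y′ n) < ε
    go (K , M , 0<K , x≤K) = scale (divide-ε 0<K 0<ε)
      where
      scale : ∃[ δ ] 0ℚ < δ × K ℚ.* δ ≡ ε →
              ∃[ N ] ∀ n → N ℕ.≤ n → abs (seq x n ℚ.* seq y n - seq x n ℚ.* seq y′ n) < ε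
      scale (δ , 0<δ , Kδ≡ε) = let N , h = y≈y′ δ 0<δ in M ℕ.⊔ N , λ n p → begin-strict
        abs (seq x n ℚ.* seq y n - seq x n ℚ.* seq y′ n)
          ≡⟨ cong abs (solve 3 (λ x y z → x :* y :- x :* z := x :* (y :- z)) refl
               (seq x n) (seq y n) (seq y′ n)) ⟩
        abs (seq x n ℚ.* (seq y n - seq y′ n))
          <⟨ *-bound (seq x n) (seq y n - seq y′ n) 0<K
               (x≤K n (ℕ.m⊔n≤o⇒m≤o M N p)) (h n (ℕ.m⊔n≤o⇒n≤o M N p)) ⟩
        K ℚ.* δ
          ≡⟨ Kδ≡ε ⟩
        ε ∎

  *-comm : ∀ x y → x * y ≃ y * x
  *-comm x y = ≗⇒≃ λ n → ℚ.*-comm (seq x n) (seq y n)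

  *-cong : ∀ {x x′ y y′} → x ≃ x′ → y ≃ y′ → x * y ≃ x′ * y′
  *-cong {x} {x′} {y} {y′} x≃x′ y≃y′ =
    ≃-trans {x * y} {x * y′} {x′ * y′} (*-congˡ x {y} {y′} y≃y′)
      (≃-trans {x * y′} {y′ * x} {x′ * y′} (*-comm x y′)
        (≃-trans {y′ * x} {y′ * x′} {x′ * y′} (*-congˡ y′ {x} {x′} x≃x′) (*-comm y′ x′)))

  -1*p≡-p : ∀ p → ℚ.- 1ℚ ℚ.* p ≡ ℚ.- p
  -1*p≡-p p = trans (sym (ℚ.neg-distribˡ-* 1ℚ p)) (cong ℚ.-_ (ℚ.*-identityˡ p))

  -- Were negation to unfold, conversion checking would compare Cauchy proofs.
  abstract
    neg : ℝ → ℝ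
    neg x = fromℚ (ℚ.- 1ℚ) * x

    neg-cong : ∀ {x y} → x ≃ y → neg x ≃ neg y
    neg-cong {x} {y} x≃y .close ε 0<ε = close (*-congˡ (fromℚ (ℚ.- 1ℚ)) {x} {y} x≃y) ε 0<ε

    neg-inverseˡ : ∀ x → neg x + x ≃ 0ℝ
    neg-inverseˡ x = ≗⇒≃ λ n → trans
      (cong (ℚ._+ seq x n) (-1*p≡-p (seq x n)))
      (ℚ.+-inverseˡ (seq x n))

    neg-inverseʳ : ∀ x → x + neg x ≃ 0ℝ
    neg-inverseʳ x = ≗⇒≃ λ n → trans
      (cong (seq x n ℚ.+_) (-1*p≡-p (seq x n)))
      (ℚ.+-inverseʳ (seq x n))

  ≃-isEquivalence : IsEquivalence _≃_
  ≃-isEquivalence = record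
    { refl  = λ {x} → ≃-refl {x}
    ; sym   = λ {x} {y} → ≃-sym {x} {y}
    ; trans = λ {x} {y} {z} → ≃-trans {x} {y} {z}
    }

  +-identityʳ : ∀ x → x + 0ℝ ≃ x
  +-identityʳ x = ≗⇒≃ λ n → ℚ.+-identityʳ (seq x n)

  *-identityʳ : ∀ x → x * 1ℝ ≃ x
  *-identityʳ x = ≗⇒≃ λ n → ℚ.*-identityʳ (seq x n)

  *-distribʳ-+ : ∀ x y z → (y + z) * x ≃ y * x + z * x
  *-distribʳ-+ x y z = ≗⇒≃ λ n → ℚ.*-distribʳ-+ (seq x n) (seq y n) (seq z n)

  +-comm : ∀ x y → x + y ≃ y + x
  +-comm x y = ≗⇒≃ λ n → ℚ.+-comm (seq x n) (seq y n)

  +-assoc : ∀ x y z → x + y + z ≃ x + (y + z)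
  +-assoc x y z = ≗⇒≃ λ n → ℚ.+-assoc (seq x n) (seq y n) (seq z n)

  +-identityˡ : ∀ x → 0ℝ + x ≃ x
  +-identityˡ x = ≗⇒≃ λ n → ℚ.+-identityˡ (seq x n)

  *-assoc : ∀ x y z → x * y * z ≃ x * (y * z)
  *-assoc x y z = ≗⇒≃ λ n → ℚ.*-assoc (seq x n) (seq y n) (seq z n)

  *-identityˡ : ∀ x → 1ℝ * x ≃ x
  *-identityˡ x = ≗⇒≃ λ n → ℚ.*-identityˡ (seq x n)

  *-distribˡ-+ : ∀ x y z → x * (y + z) ≃ x * y + x * z
  *-distribˡ-+ x y z = ≗⇒≃ λ n → ℚ.*-distribˡ-+ (seq x n) (seq y n) (seq z n)

  +-isGroup : IsGroup _≃_ _+_ 0ℝ neg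
  +-isGroup = record
    { isMonoid = record
      { isSemigroup = record
        { isMagma = record
          { isEquivalence = ≃-isEquivalence
          ; ∙-cong = λ {x} {x′} {y} {y′} → +-cong {x} {x′} {y} {y′} }
        ; assoc = +-assoc }
      ; identity = +-identityˡ , +-identityʳ }
    ; inverse = neg-inverseˡ , neg-inverseʳ
    ; ⁻¹-cong = λ {x} {y} → neg-cong {x} {y}
    }

  isRing : IsRing _≃_ _+_ _*_ neg 0ℝ 1ℝ
  isRing = record
    { +-isAbelianGroup = record { isGroup = +-isGroup ; comm = +-comm }
    ; *-cong           = λ {x} {x′} {y} {y′} → *-cong {x} {x′} {y} {y′}
    ; *-assoc          = *-assoc
    ; *-identity       = *-identityˡ , *-identityʳ
    ; distrib          = *-distribˡ-+ , *-distribʳ-+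
    }

  ring : CommutativeRing 0ℓ 0ℓ
  ring = record { isCommutativeRing = record { isRing = isRing ; *-comm = *-comm } }

  -- The constructive counterpart of being nonzero.
  Apart : ℝ → Set
  Apart x = ∃[ δ ] 0ℚ < δ × ∃[ N ] ∀ n → N ℕ.≤ n → δ ≤ abs (seq x n)

  -- Otherwise `p - q` and `q` would both be below half of `δ`, and their sum `p` below `δ`.
  half-≤-abs : ∀ {δ} p q → δ ≤ abs p → abs (p - q) < ½ ℚ.* δ → ½ ℚ.* δ ≤ abs q
  half-≤-abs {δ} p q δ≤p p-q<δ/2 = ℚ.≮⇒≥ λ q<δ/2 →
    ℚ.<-irrefl refl (ℚ.<-≤-trans (abs-sum-< (p - q) q p (telescope p q) p-q<δ/2 q<δ/2) δ≤p)

  Apart-resp : ∀ {x y} → x ≃ y → Apart x → Apart y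
  Apart-resp {x} {y} (equal x≈y) (δ , 0<δ , M , δ≤x) with x≈y _ (half>0 0<δ)
  ... | N , h = ½ ℚ.* δ , half>0 0<δ , M ℕ.⊔ N , λ n p →
    half-≤-abs (seq x n) (seq y n) (δ≤x n (ℕ.m⊔n≤o⇒m≤o M N p)) (h n (ℕ.m⊔n≤o⇒n≤o M N p))

  Apart-fromℚ : ∀ {q} → q ≢ 0ℚ → Apart (fromℚ q)
  Apart-fromℚ {q} q≢0 = abs q , ℚ.≰⇒> (λ ∣q∣≤0 →
      q≢0 (ℚ.∣p∣≡0⇒p≡0 q (ℚ.≤-antisym ∣q∣≤0 (ℚ.0≤∣p∣ q)))) ,
    0 , λ _ _ → ℚ.≤-refl

  ¬Apart-0 : ¬ Apart 0ℝ
  ¬Apart-0 (δ , 0<δ , N , δ≤0) = ℚ.<-irrefl refl (ℚ.<-≤-trans 0<δ (δ≤0 N ℕ.≤-refl))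

  Apart-* : ∀ {x y} → Apart x → Apart y → Apart (x * y)
  Apart-* {x} {y} (δ , 0<δ , M , δ≤x) (η , 0<η , N , η≤y) =
    δ ℚ.* η , ℚ.positive⁻¹ _ {{ℚ.pos*pos⇒pos δ η}} , M ℕ.⊔ N , λ n p → begin
      δ ℚ.* η                          ≤⟨ ℚ.*-monoʳ-≤-nonNeg η {{ℚ.pos⇒nonNeg η}} (δ≤x n (ℕ.m⊔n≤o⇒m≤o M N p)) ⟩
      abs (seq x n) ℚ.* η              ≤⟨ ℚ.*-monoˡ-≤-nonNeg (abs (seq x n)) {{ℚ.∣-∣-nonNeg (seq x n)}}
                                            (η≤y n (ℕ.m⊔n≤o⇒n≤o M N p)) ⟩
      abs (seq x n) ℚ.* abs (seq y n)  ≡⟨ ℚ.∣p*q∣≡∣p∣*∣q∣ (seq x n) (seq y n) ⟨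
      abs (seq x n ℚ.* seq y n)        ∎
    where
    open ℚ.≤-Reasoning
    instance
      δ-pos = ℚ.positive 0<δ
      η-pos = ℚ.positive 0<η

  -- If `y` is eventually bounded by `K`, a product at least `δ` in absolute value leaves at least
  -- `δ / K` for `x`.
  Apart-*⁻ˡ : ∀ {x y} → Apart (x * y) → Apart x
  Apart-*⁻ˡ {x} {y} (δ , 0<δ , M , δ≤xy) = go (bounded (cauchy y))
    where
    open ℚ.≤-Reasoning

    go : EventuallyBounded (seq y) → Apart x
    go (K , N , 0<K , y≤K) = scale (divide-ε 0<K 0<δ)
      where
      scale : ∃[ η ] 0ℚ < η × K ℚ.* η ≡ δ → Apart x
      scale (η , 0<η , Kη≡δ) = η , 0<η , M ℕ.⊔ N , λ n p → ℚ.*-cancelˡ-≤-pos K {{ℚ.positive 0<K}} (begin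
        K ℚ.* η                          ≡⟨ Kη≡δ ⟩
        δ                                ≤⟨ δ≤xy n (ℕ.m⊔n≤o⇒m≤o M N p) ⟩
        abs (seq x n ℚ.* seq y n)        ≡⟨ ℚ.∣p*q∣≡∣p∣*∣q∣ (seq x n) (seq y n) ⟩
        abs (seq x n) ℚ.* abs (seq y n)  ≤⟨ ℚ.*-monoˡ-≤-nonNeg (abs (seq x n)) {{ℚ.∣-∣-nonNeg (seq x n)}}
                                              (y≤K n (ℕ.m⊔n≤o⇒n≤o M N p)) ⟩
        abs (seq x n) ℚ.* K              ≡⟨ ℚ.*-comm (abs (seq x n)) K ⟩
        K ℚ.* abs (seq x n)              ∎)

  -- One sufficiently late index decides which summand stays away from zero.
  Apart-+⁻ : ∀ {x y} → Apart (x + y) → Apart x ⊎ Apart y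
  Apart-+⁻ {x} {y} (δ , 0<δ , M , δ≤x+y)
    with cauchy x _ (half>0 (half>0 0<δ)) | cauchy y _ (half>0 (half>0 0<δ))
  ... | N , cx | P , cy = decide (ℚ.≤-total (½ ℚ.* δ) (abs (seq x R)))
    where
    R = M ℕ.⊔ (N ℕ.⊔ P)

    N≤R : N ℕ.≤ R
    N≤R = ℕ.≤-trans (ℕ.m≤m⊔n N P) (ℕ.m≤n⊔m M (N ℕ.⊔ P))

    P≤R : P ℕ.≤ R
    P≤R = ℕ.≤-trans (ℕ.m≤n⊔m N P) (ℕ.m≤n⊔m M (N ℕ.⊔ P))

    stays : ∀ {z} Q → Q ℕ.≤ R → (∀ m n → Q ℕ.≤ m → Q ℕ.≤ n → abs (seq z m - seq z n) < ½ ℚ.* (½ ℚ.* δ)) →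
            ½ ℚ.* δ ≤ abs (seq z R) → Apart z
    stays {z} Q Q≤R cz large = _ , half>0 (half>0 0<δ) , R , λ n R≤n →
      half-≤-abs (seq z R) (seq z n) large (cz R n Q≤R (ℕ.≤-trans Q≤R R≤n))

    decide : ½ ℚ.* δ ≤ abs (seq x R) ⊎ abs (seq x R) ≤ ½ ℚ.* δ → Apart x ⊎ Apart y
    decide (inj₁ large) = inj₁ (stays {x} N N≤R cx large)
    decide (inj₂ small) = inj₂ (stays {y} P P≤R cy (ℚ.≮⇒≥ λ y<δ/2 → ℚ.<-irrefl refl (begin-strict
      δ                                ≤⟨ δ≤x+y R (ℕ.m≤m⊔n M (N ℕ.⊔ P)) ⟩
      abs (seq x R ℚ.+ seq y R)        ≤⟨ ℚ.∣p+q∣≤∣p∣+∣q∣ (seq x R) (seq y R) ⟩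
      abs (seq x R) ℚ.+ abs (seq y R)  <⟨ ℚ.+-mono-≤-< small y<δ/2 ⟩
      ½ ℚ.* δ ℚ.+ ½ ℚ.* δ              ≡⟨ half+half δ ⟩
      δ                                ∎)))
      where open ℚ.≤-Reasoning

  reals : ApartDomain
  reals = record
    { commutativeRing = ring
    ; Apart           = Apart
    ; Apart-resp      = λ {x} {y} → Apart-resp {x} {y}
    ; Apart-*         = λ {x} {y} → Apart-* {x} {y}
    ; Apart-*⁻ˡ       = λ {x} {y} → Apart-*⁻ˡ {x} {y}
    ; Apart-+⁻        = λ {x} {y} → Apart-+⁻ {x} {y}
    ; ¬Apart-0        = ¬Apart-0
    ; ι               = fromℚ
    ; ι-0             = ≗⇒≃ λ _ → refl
    ; ι-1             = ≗⇒≃ λ _ → refl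
    ; ι-+             = λ _ _ → ≗⇒≃ λ _ → refl
    ; Apart-ι         = λ {q} → Apart-fromℚ {q}
    }

-- The bound for sets of real vectors.

open import Defs using (ℝ^_; _≈_; _≋_; 0ℝ; 1ℝ; ⟨_,_⟩; Spans; ∣_∣·∣_∣≤_)
open import Data.Nat.Base using (_+_; _*_; _^_)

theorem1 : ∀ {ℓ₁ ℓ₂ : Level} (d : ℕ) (A : Pred (ℝ^ d) ℓ₁) (B : Pred (ℝ^ d) ℓ₂) →
    A Respects _≋_ → B Respects _≋_ →
    Spans A → Spans B →
    (∀ a b → a ∈ A → b ∈ B → (⟨ a , b ⟩ ≈ 0ℝ) ⊎ (⟨ a , b ⟩ ≈ 1ℝ)) →
    ∣ A ∣·∣ B ∣≤ ((d + 1) * 2 ^ d)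
theorem1 d A B _ _ A-spans B-spans binary m n (f , f∈A , f-injective) (g , g∈B , g-injective) =
  -- The cardinality bound unfolds to one on injective finite families `f` and `g`, to which
  -- `finite-bound` applies.
  subst (λ k → m * n ℕ.≤ k * 2 ^ d) (ℕ.+-comm 1 d)
    (finite-bound (spansUnits A A-spans) (spansUnits B B-spans)
      (λ a b a∈A b∈B → Sum.map equal equal (binary a b a∈A b∈B))
      (λ i → f i , f∈A i) (λ i → g i , g∈B i)
      (λ eq → f-injective λ k → close (eq k)) (λ eq → g-injective λ k → close (eq k)))
  where
  open RealNumbers
  open _≃_
  open LinearAlgebra reals

  spansUnits : ∀ {ℓ} (X : Pred (ℝ^ d) ℓ) → Spans X → SpansUnits X
  spansUnits _ spans i = let k , c , v , v∈X , unit≈ = spans (unit i) in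
    k , c , v , v∈X , λ l → equal (unit≈ l)
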